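{- For $n\in\mathbb{N}$, let $F(n)=\#\{(x,y)\in\mathbb{Z}^2 : x^2+y^2\le n\}$ be the number of lattice points in a disc of radius $\sqrt{n}$ centered at the origin. Then $$F(n) = 4\,\mathcal{N}_{\lceil n/2\rceil,\,1/2,\,\{n/2\},\,1,\,2}+4\left\lfloor\frac{n}{2}\right\rfloor+1,$$ where $\{n/2\}$ denotes the fractional part of $n/2$.
   Context: $\mathbb{N}$ denotes the set of positive integers; $\lfloor\cdot\rfloor$ and $\lceil\cdot\rceil$ are the floor and ceiling functions, and $\{x\}=x-\lfloor x\rfloor$. For $n,m\in\mathbb{N}$, $r\in\mathbb{Z}$ and $\alpha,\nu\in\mathbb{R}$, define $$\mathcal{N}_{n,\alpha,\nu,r,m}=\#\left\{k\in\mathbb{Z} : 1\le k\le n,\ \left\lfloor\frac{n-\nu}{k}+\alpha\right\rfloor\equiv r \pmod m\right\}.$$ -}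

module Defs where

open import Data.Nat.Base as ℕ using (ℕ; zero; suc; s≤s)
import Data.Nat.Properties as ℕ
open import Data.Integer.Base as ℤ using (ℤ; +_; -[1+_]; ∣_∣)
import Data.Integer.Properties as ℤ
open import Data.Integer.Divisibility.Signed using (_∣_; _∣?_)
open import Data.Rational.Base as ℚ using (ℚ; _/_; floor)
open import Data.List.Base using (List; length; filter; map; upTo; _++_; cartesianProduct)
open import Data.List.Membership.Propositional using (_∈_)
open import Data.List.Membership.Propositional.Properties
  using (∈-filter⁺; ∈-filter⁻; ∈-map⁺; ∈-map⁻; ∈-++⁺ˡ; ∈-++⁺ʳ; ∈-upTo⁺; ∈-cartesianProduct⁺)
open import Data.List.Relation.Unary.Unique.Propositional using (Unique)
import Data.List.Relation.Unary.Unique.Propositional.Properties as Unique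
open import Data.Product.Base using (Σ; _×_; _,_; proj₂)
open import Relation.Binary.PropositionalEquality using (_≡_; refl; sym; trans; cong; subst)
open import Relation.Nullary using (yes; no; _×-dec_)
open import Relation.Unary using (Pred; Decidable)
open import Level using (0ℓ)

-- A finite set { x : A | P x }, witnessed by a duplicate-free list of exactly
-- its elements; its cardinality is the length of any such list.
record Finite {A : Set} (P : Pred A 0ℓ) : Set where
  field
    elements : List A
    unique   : Unique elements
    sound    : ∀ {x} → x ∈ elements → P x
    complete : ∀ {x} → P x → x ∈ elements

card : {A : Set} {P : Pred A 0ℓ} → Finite P → ℕ
card fin = length (Finite.elements fin)

finite-dec : {A : Set} {P : Pred A 0ℓ} → Decidable P →
             (xs : List A) → Unique xs → (∀ {x} → P x → x ∈ xs) → Finite P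
finite-dec P? xs u bound = record
  { elements = filter P? xs
  ; unique   = Unique.filter⁺ P? u
  ; sound    = λ x∈ → proj₂ (∈-filter⁻ P? {xs = xs} x∈)
  ; complete = λ p → ∈-filter⁺ P? (bound p) p
  }

_≡_[mod_] : ℤ → ℤ → ℕ → Set
a ≡ b [mod m ] = + m ∣ a ℤ.- b

-- x - ⌊x⌋; the library's fracPart truncates towards zero instead.
frac : ℚ → ℚ
frac x = x ℚ.- (floor x / 1)

module _ (n : ℕ) (α ν : ℚ) (r : ℤ) (m : ℕ) where

  -- Division by k is written as multiplication by 1 / k.
  floorTerm : (k : ℕ) .{{_ : ℕ.NonZero k}} → ℤ
  floorTerm k = floor (((+ n / 1) ℚ.- ν) ℚ.* (+ 1 / k) ℚ.+ α)

  Counted : Pred ℕ 0ℓ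
  Counted k = Σ (1 ℕ.≤ k) λ 1≤k →
    k ℕ.≤ n × floorTerm k {{ℕ.>-nonZero 1≤k}} ≡ r [mod m ]

  counted? : Decidable Counted
  counted? zero = no λ ()
  counted? (suc j)
    with (suc j ℕ.≤? n) ×-dec (+ m ∣? floorTerm (suc j) ℤ.- r)
  ... | yes p = yes (s≤s ℕ.z≤n , p)
  ... | no ¬p = no λ (_ , p) → ¬p p

  counted-finite : Finite Counted
  counted-finite = finite-dec counted? (upTo (suc n)) (Unique.upTo⁺ (suc n))
    λ (_ , k≤n , _) → ∈-upTo⁺ (s≤s k≤n)

𝒩 : (n : ℕ) (α ν : ℚ) (r : ℤ) (m : ℕ) → ℕ
𝒩 n α ν r m = card (counted-finite n α ν r m)

InDisc : ℕ → Pred (ℤ × ℤ) 0ℓ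
InDisc n (x , y) = x ℤ.^ 2 ℤ.+ y ℤ.^ 2 ℤ.≤ + n

inDisc? : ∀ n → Decidable (InDisc n)
inDisc? n (x , y) = _ ℤ.≤? _

-- All integers x with -n ≤ x ≤ n.
interval : ℕ → List ℤ
interval n = map +_ (upTo (suc n)) ++ map -[1+_] (upTo n)

interval-unique : ∀ n → Unique (interval n)
interval-unique n = Unique.++⁺
  (Unique.map⁺ ℤ.+-injective (Unique.upTo⁺ (suc n)))
  (Unique.map⁺ ℤ.-[1+-injective (Unique.upTo⁺ n))
  λ (p , q) → disjoint (∈-map⁻ +_ p) (∈-map⁻ -[1+_] q)
  where
  open import Data.Empty using (⊥)
  disjoint : ∀ {z : ℤ} → (Σ ℕ λ i → i ∈ upTo (suc n) × z ≡ + i) →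
             (Σ ℕ λ i → i ∈ upTo n × z ≡ -[1+ i ]) → ⊥
  disjoint (_ , _ , refl) (_ , _ , ())

∈-interval : ∀ {n} x → ∣ x ∣ ℕ.≤ n → x ∈ interval n
∈-interval {n} (+ i)    i≤n = ∈-++⁺ˡ (∈-map⁺ +_ (∈-upTo⁺ (s≤s i≤n)))
∈-interval {n} -[1+ i ] i<n = ∈-++⁺ʳ (map +_ (upTo (suc n))) (∈-map⁺ -[1+_] (∈-upTo⁺ i<n))

square-abs : ∀ x → x ℤ.^ 2 ≡ + (∣ x ∣ ℕ.* ∣ x ∣)
square-abs x = trans (cong (x ℤ.*_) (ℤ.*-identityʳ x)) (lemma x)
  where
  lemma : ∀ x → x ℤ.* x ≡ + (∣ x ∣ ℕ.* ∣ x ∣)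
  lemma (+ i)    = sym (ℤ.pos-* i i)
  lemma -[1+ i ] = refl

m≤m*m : ∀ m → m ℕ.≤ m ℕ.* m
m≤m*m zero    = ℕ.z≤n
m≤m*m (suc m) = ℕ.m≤m*n (suc m) (suc m)

inDisc-bounded : ∀ {n} ((x , y) : ℤ × ℤ) → InDisc n (x , y) → ∣ x ∣ ℕ.≤ n × ∣ y ∣ ℕ.≤ n
inDisc-bounded {n} (x , y) p =
  ℕ.≤-trans (m≤m*m ∣ x ∣) (ℕ.≤-trans (ℕ.m≤m+n _ _) q) ,
  ℕ.≤-trans (m≤m*m ∣ y ∣) (ℕ.≤-trans (ℕ.m≤n+m _ _) q)
  where
  q : ∣ x ∣ ℕ.* ∣ x ∣ ℕ.+ ∣ y ∣ ℕ.* ∣ y ∣ ℕ.≤ n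
  q rewrite square-abs x | square-abs y = ℤ.drop‿+≤+ p

disc-finite : ∀ n → Finite (InDisc n)
disc-finite n = finite-dec (inDisc? n)
  (cartesianProduct (interval n) (interval n))
  (Unique.cartesianProduct⁺ (interval-unique n) (interval-unique n))
  λ {(x , y)} p → let (∣x∣≤n , ∣y∣≤n) = inDisc-bounded (x , y) p in
    ∈-cartesianProduct⁺ (∈-interval x ∣x∣≤n) (∈-interval y ∣y∣≤n)

F : ℕ → ℕ
F n = card (disc-finite n)

{-# OPTIONS --safe #-}

-- F(n) counts the lattice points by their norm z. Let χ be the nonprincipal
-- character modulo 4, E(z) the sum of χ over the divisors of z, and r₂(z) the number of
-- representations of z as a sum of two squares.  By Jacobi's theorem r₂ = 4 E on z > 0,
-- F(n) = 1 + 4 ∑_{k ≤ n} c(⌊n/k⌋) where c(m) = χ(1) + … + χ(m) is 1 if m ≡ 1, 2 (mod 4)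
-- and 0 otherwise.  Thus c(⌊n/k⌋) = 1 exactly when ⌊(⌊n/k⌋ + 1)/2⌋ = ⌊(n/2)/k + 1/2⌋ is
-- odd, and every k with ⌈n/2⌉ < k ≤ n contributes 1.
--
-- Jacobi's theorem follows from a recurrence that determines r₂(n) from smaller values.
-- Symmetry in x, y, z gives ∑ (n − 3x²) = 0 over x² + y² + z² = n, that is
-- ∑_i (n − 3i²) r₂(n − i²) = 0.  The same recurrence for 4 E, up to its value at 0, is
-- Liouville's: over the triples with i² + dδ = n and d, δ > 0, replacing i by −i turns
-- (n − 3i²) χ(δ) into G = (δ − 2i)(d + i) χ(δ).  Split by the sign of t = d + 2i − δ.
-- Where t > 0, G is odd under the involution (i, d, δ) ↦ (δ − i, t, δ).  The triples with
-- t < 0 go to those with t > 0 by (i, d, δ) ↦ (i + d, −t, d), which turns G into a function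
-- whose sum vanishes by further symmetries.  Where t = 0, n = (d + i)² is a square and
-- the sum is explicit.
module Submission where

open import Defs
open import Data.Empty using (⊥-elim)
open import Data.Integer.Divisibility.Signed using (_∣_; _∣?_; ∣-refl; ∣m∣n⇒∣m+n; ∣m+n∣m⇒∣n)
import Data.Integer.Properties as ℤ
open import Data.Integer.Tactic.RingSolver using (solve-∀)
open import Data.List.Base using (List; []; _∷_; length; drop; filter; map; downFrom; _++_; cartesianProduct)
open import Data.List.Membership.Propositional using (_∈_)
open import Data.List.Membership.Propositional.Properties
open import Data.List.Membership.Propositional.Properties.WithK using (unique∧set⇒bag)
open import Data.List.Properties using (map-∘; map-id-local)
open import Data.List.Relation.Binary.BagAndSetEquality using (∼bag⇒↭)
open import Data.List.Relation.Binary.Permutation.Propositional using (_↭_; prep; swap)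
open import Data.List.Relation.Unary.All as All using (All)
open import Data.List.Relation.Unary.AllPairs as AllPairs using ([]; _∷_)
open import Data.List.Relation.Unary.Any using (here; there)
open import Data.List.Relation.Unary.Unique.Propositional using (Unique)
import Data.List.Relation.Unary.Unique.Propositional.Properties as Unique
open import Data.Nat.Base as ℕ using (ℕ; zero; suc; z≤n; s≤s)
import Data.Nat.DivMod as ℕ
open import Data.Nat.Induction using (<-rec)
import Data.Nat.Properties as ℕ
open import Data.Product.Base using (Σ; _×_; _,_; proj₁; proj₂; map₁)
open import Data.Rational.Base as ℚ using (ℚ)
import Data.Rational.Properties as ℚ
import Data.Rational.Unnormalised.Base as ℚᵘ
import Data.Rational.Unnormalised.Properties as ℚᵘ
open import Data.Sum.Base using (_⊎_; inj₁; inj₂)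
open import Function.Base using (_∘_; id)
open import Function.Bundles using (mk⇔)
open import Level using (0ℓ)
open import Relation.Binary.PropositionalEquality
open import Relation.Nullary using (¬_; ¬?; yes; no; _×-dec_)
open import Relation.Nullary.Decidable using (from-yes; from-no)
open import Relation.Unary using (Pred; Decidable; _∩_)

module DiscCount where
  open import Data.Integer.Base hiding (suc; pred)

  private variable
    A B : Set
    P : Pred A 0ℓ

  -- Finite sums

  +-congˡ : ∀ x {y z} → y ≡ z → x + y ≡ x + z
  +-congˡ x = cong λ y → x + y

  ∑ : List A → (A → ℤ) → ℤ
  ∑ []       f = 0ℤ
  ∑ (x ∷ xs) f = f x + ∑ xs f

  ∑-cong-∈ : ∀ (xs : List A) {f g} → (∀ {x} → x ∈ xs → f x ≡ g x) → ∑ xs f ≡ ∑ xs g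
  ∑-cong-∈ []       eq = refl
  ∑-cong-∈ (x ∷ xs) eq = cong₂ _+_ (eq (here refl)) (∑-cong-∈ xs (eq ∘ there))

  ∑-zero-∈ : ∀ (xs : List A) {f} → (∀ {x} → x ∈ xs → f x ≡ 0ℤ) → ∑ xs f ≡ 0ℤ
  ∑-zero-∈ []       eq = refl
  ∑-zero-∈ (x ∷ xs) eq = cong₂ _+_ (eq (here refl)) (∑-zero-∈ xs (eq ∘ there))

  ∑-+ : ∀ (xs : List A) f g → ∑ xs (λ x → f x + g x) ≡ ∑ xs f + ∑ xs g
  ∑-+ []       f g = refl
  ∑-+ (x ∷ xs) f g rewrite ∑-+ xs f g = lemma (f x) (g x) (∑ xs f) (∑ xs g)
    where
    lemma : ∀ a b c d → a + b + (c + d) ≡ a + c + (b + d)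
    lemma = solve-∀

  ∑-*ˡ : ∀ (xs : List A) c f → ∑ xs (λ x → c * f x) ≡ c * ∑ xs f
  ∑-*ˡ []       c f = sym (ℤ.*-zeroʳ c)
  ∑-*ˡ (x ∷ xs) c f rewrite ∑-*ˡ xs c f = sym (ℤ.*-distribˡ-+ c (f x) (∑ xs f))

  ∑-++ : ∀ (xs ys : List A) f → ∑ (xs ++ ys) f ≡ ∑ xs f + ∑ ys f
  ∑-++ []       ys f = sym (ℤ.+-identityˡ _)
  ∑-++ (x ∷ xs) ys f rewrite ∑-++ xs ys f = sym (ℤ.+-assoc (f x) (∑ xs f) (∑ ys f))

  ∑-map : ∀ (g : A → B) xs f → ∑ (map g xs) f ≡ ∑ xs (f ∘ g)
  ∑-map g []       f = refl
  ∑-map g (x ∷ xs) f = +-congˡ (f (g x)) (∑-map g xs f)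

  ∑-↭ : ∀ {xs ys : List A} f → xs ↭ ys → ∑ xs f ≡ ∑ ys f
  ∑-↭ f _↭_.refl = refl
  ∑-↭ f (prep x p) = +-congˡ (f x) (∑-↭ f p)
  ∑-↭ f (swap {xs} {ys} x y p) rewrite ∑-↭ f p = lemma (f x) (f y) (∑ ys f)
    where
    lemma : ∀ a b c → a + (b + c) ≡ b + (a + c)
    lemma = solve-∀
  ∑-↭ f (_↭_.trans p q) = trans (∑-↭ f p) (∑-↭ f q)

  ∑-filter : ∀ {Q : Pred A 0ℓ} (Q? : Decidable Q) xs f →
             ∑ xs f ≡ ∑ (filter Q? xs) f + ∑ (filter (¬? ∘ Q?) xs) f
  ∑-filter Q? [] f = refl
  ∑-filter Q? (x ∷ xs) f with Q? x
  ... | yes q rewrite ∑-filter Q? xs f = sym (ℤ.+-assoc (f x) _ _)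
  ... | no ¬q rewrite ∑-filter Q? xs f = lemma (f x) (∑ (filter Q? xs) f) _
    where
    lemma : ∀ a b c → a + (b + c) ≡ b + (a + c)
    lemma = solve-∀

  ∑ᶠ : Finite P → (_ → ℤ) → ℤ
  ∑ᶠ P = ∑ (Finite.elements P)

  ∑ᶠ-cong : (p : Finite P) {f g : _ → ℤ} → (∀ {x} → P x → f x ≡ g x) → ∑ᶠ p f ≡ ∑ᶠ p g
  ∑ᶠ-cong p eq = ∑-cong-∈ (elements p) (eq ∘ sound p)
    where open Finite

  ∑ᶠ-+ : (p : Finite P) (f g : _ → ℤ) → ∑ᶠ p (λ x → f x + g x) ≡ ∑ᶠ p f + ∑ᶠ p g
  ∑ᶠ-+ p = ∑-+ (Finite.elements p)

  ∑ᶠ-*ˡ : (p : Finite P) (k : ℤ) (f : _ → ℤ) → ∑ᶠ p (λ x → k * f x) ≡ k * ∑ᶠ p f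
  ∑ᶠ-*ˡ p = ∑-*ˡ (Finite.elements p)

  ∑ᶠ-zero : (p : Finite P) {f : _ → ℤ} → (∀ {x} → P x → f x ≡ 0ℤ) → ∑ᶠ p f ≡ 0ℤ
  ∑ᶠ-zero p eq = ∑-zero-∈ (elements p) (eq ∘ sound p)
    where open Finite

  -- Bijections between finite sets and reindexing of sums

  record _≅_ {A B : Set} (P : Pred A 0ℓ) (Q : Pred B 0ℓ) : Set where
    field
      to      : A → B
      from    : B → A
      to-∈    : ∀ {x} → P x → Q (to x)
      from-∈  : ∀ {y} → Q y → P (from y)
      -- The maps are total on the ambient types and inverse only on the subsets. This admits maps
      -- such as `ℕ.pred` and `proj₂`, which are invertible only there.
      from-to : ∀ {x} → P x → from (to x) ≡ x
      to-from : ∀ {y} → Q y → to (from y) ≡ y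

  involution : {P : Pred A 0ℓ} (φ : A → A) → (∀ {x} → P x → P (φ x)) →
               (∀ {x} → P x → φ (φ x) ≡ x) → P ≅ P
  involution φ φ-∈ φφ = record
    { to = φ; from = φ; to-∈ = φ-∈; from-∈ = φ-∈; from-to = φφ; to-from = φφ }

  identity : {P Q : Pred A 0ℓ} → (∀ {x} → P x → Q x) → (∀ {x} → Q x → P x) → P ≅ Q
  identity P⊆Q Q⊆P = record
    { to = id; from = id; to-∈ = P⊆Q; from-∈ = Q⊆P
    ; from-to = λ _ → refl; to-from = λ _ → refl }

  module _ {A B : Set} {P : Pred A 0ℓ} {Q : Pred B 0ℓ}
           (p : Finite P) (q : Finite Q) (P≅Q : P ≅ Q) where
    open Finite
    open _≅_ P≅Q

    -- `to` need not be injective on all of `A`, so its image is sent back by `from`: this recovers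
    -- the original list, and a list whose image has no duplicates has none itself.
    to-elements-unique : Unique (map to (elements p))
    to-elements-unique = Unique.map⁻ {f = from} (subst Unique (sym from-to-elements) (unique p))
      where
      from-to-elements : map from (map to (elements p)) ≡ elements p
      from-to-elements = trans (sym (map-∘ (elements p)))
        (map-id-local (All.tabulate (from-to ∘ sound p)))

    -- Two duplicate-free lists with the same members are permutations of each other.
    to-elements-↭ : map to (elements p) ↭ elements q
    to-elements-↭ = ∼bag⇒↭ (unique∧set⇒bag to-elements-unique (unique q) (mk⇔ ⊆ ⊇))
      where
      ⊆ : ∀ {y} → y ∈ map to (elements p) → y ∈ elements q
      ⊆ y∈ with ∈-map⁻ to y∈
      ... | x , x∈ , refl = complete q (to-∈ (sound p x∈))
      ⊇ : ∀ {y} → y ∈ elements q → y ∈ map to (elements p)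
      ⊇ y∈ = subst (_∈ _) (to-from (sound q y∈))
        (∈-map⁺ to (complete p (from-∈ (sound q y∈))))

    ∑ᶠ-≅ : {f : A → ℤ} {g : B → ℤ} → (∀ {x} → P x → f x ≡ g (to x)) → ∑ᶠ p f ≡ ∑ᶠ q g
    ∑ᶠ-≅ {f} {g} eq = begin
      ∑ (elements p) f          ≡⟨ ∑ᶠ-cong p eq ⟩
      ∑ (elements p) (g ∘ to)   ≡⟨ ∑-map to (elements p) g ⟨
      ∑ (map to (elements p)) g ≡⟨ ∑-↭ g to-elements-↭ ⟩
      ∑ (elements q) g          ∎
      where open ≡-Reasoning

  ≡-neg⇒≡0 : ∀ {x} → x ≡ - x → x ≡ 0ℤ
  ≡-neg⇒≡0 {+0} _ = refl

  ∑ᶠ-neg : (p : Finite P) (f : _ → ℤ) → ∑ᶠ p (λ x → - f x) ≡ - ∑ᶠ p f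
  ∑ᶠ-neg p f = begin
    ∑ᶠ p (λ x → - f x)      ≡⟨ ∑ᶠ-cong p (λ {x} _ → sym (ℤ.-1*i≡-i (f x))) ⟩
    ∑ᶠ p (λ x → -1ℤ * f x)  ≡⟨ ∑-*ˡ (Finite.elements p) -1ℤ f ⟩
    -1ℤ * ∑ᶠ p f            ≡⟨ ℤ.-1*i≡-i _ ⟩
    - ∑ᶠ p f                ∎
    where open ≡-Reasoning

  -- Reindexing by the bijection shows that the sum equals its own negative.
  ∑ᶠ-antisymmetric : (p : Finite P) (P≅P : P ≅ P) (f : _ → ℤ) →
                     (∀ {x} → P x → f (_≅_.to P≅P x) ≡ - f x) → ∑ᶠ p f ≡ 0ℤ
  ∑ᶠ-antisymmetric p P≅P f anti = ≡-neg⇒≡0 (trans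
    (∑ᶠ-≅ p p P≅P (λ {x} Px → trans (sym (ℤ.neg-involutive (f x))) (cong -_ (sym (anti Px)))))
    (∑ᶠ-neg p f))

  restrict : {Q : Pred A 0ℓ} → Decidable Q → Finite P → Finite (P ∩ Q)
  restrict Q? p = record
    { elements = filter Q? (elements p)
    ; unique   = Unique.filter⁺ Q? (unique p)
    ; sound    = λ x∈ → map₁ (sound p) (∈-filter⁻ Q? x∈)
    ; complete = λ (Px , Qx) → ∈-filter⁺ Q? (complete p Px) Qx
    }
    where open Finite

  -- Splitting a sum by the sign of a function

  module _ {A : Set} {P : Pred A 0ℓ} (p : Finite P) (t : A → ℤ) where

    onPositive : Finite (P ∩ λ x → 0ℤ < t x)
    onPositive = restrict (λ x → 0ℤ ℤ.<? t x) p

    onZero : Finite (P ∩ λ x → t x ≡ 0ℤ)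
    onZero = restrict (λ x → t x ℤ.≟ 0ℤ) p

    onNegative : Finite (P ∩ λ x → t x < 0ℤ)
    onNegative = restrict (λ x → t x ℤ.<? 0ℤ) p

    ∑ᶠ-signs : ∀ f → ∑ᶠ p f ≡ ∑ᶠ onPositive f + (∑ᶠ onZero f + ∑ᶠ onNegative f)
    ∑ᶠ-signs f = begin
      ∑ᶠ p f ≡⟨ ∑-filter (λ x → 0ℤ ℤ.<? t x) (Finite.elements p) f ⟩
      ∑ᶠ onPositive f + ∑ᶠ rest f
        ≡⟨ +-congˡ (∑ᶠ onPositive f) (∑-filter (λ x → t x ℤ.≟ 0ℤ) (Finite.elements rest) f) ⟩
      ∑ᶠ onPositive f + (∑ᶠ rest₀ f + ∑ᶠ rest₋ f)
        ≡⟨ +-congˡ (∑ᶠ onPositive f) (cong₂ _+_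
             (∑ᶠ-≅ rest₀ onZero (identity
               (λ ((Px , _) , t≡0) → Px , t≡0)
               (λ (Px , t≡0) → (Px , λ 0<t → ℤ.<-irrefl (sym t≡0) 0<t) , t≡0)) (λ _ → refl))
             (∑ᶠ-≅ rest₋ onNegative (identity
               (λ ((Px , t≯0) , t≢0) → Px , ℤ.≤∧≢⇒< (ℤ.≮⇒≥ t≯0) t≢0)
               (λ (Px , t<0) → (Px , ℤ.<-asym t<0) , ℤ.<⇒≢ t<0)) (λ _ → refl))) ⟩
      ∑ᶠ onPositive f + (∑ᶠ onZero f + ∑ᶠ onNegative f) ∎
      where
      open ≡-Reasoning
      rest = restrict (¬? ∘ λ x → 0ℤ ℤ.<? t x) p
      rest₀ = restrict (λ x → t x ℤ.≟ 0ℤ) rest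
      rest₋ = restrict (¬? ∘ λ x → t x ℤ.≟ 0ℤ) rest

  -- Summation by fibres

  module _ {B C : Set} {Q : B → Pred C 0ℓ} (fibre : ∀ b → Finite (Q b)) where
    open Finite

    dependentPairs : List B → List (B × C)
    dependentPairs []       = []
    dependentPairs (b ∷ bs) = map (b ,_) (elements (fibre b)) ++ dependentPairs bs

    ∈-dependentPairs⁻ : ∀ bs {b c} → (b , c) ∈ dependentPairs bs → b ∈ bs × Q b c
    ∈-dependentPairs⁻ (b′ ∷ bs) bc∈ with ∈-++⁻ (map (b′ ,_) (elements (fibre b′))) bc∈
    ... | inj₂ ∈bs = map₁ there (∈-dependentPairs⁻ bs ∈bs)
    ... | inj₁ ∈b′ with ∈-map⁻ (b′ ,_) ∈b′
    ...   | c , c∈ , refl = here refl , sound (fibre b′) c∈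

    ∈-dependentPairs⁺ : ∀ bs {b c} → b ∈ bs → Q b c → (b , c) ∈ dependentPairs bs
    ∈-dependentPairs⁺ (b ∷ bs) (here refl) Qbc = ∈-++⁺ˡ (∈-map⁺ (b ,_) (complete (fibre b) Qbc))
    ∈-dependentPairs⁺ (b ∷ bs) (there b∈)  Qbc = ∈-++⁺ʳ _ (∈-dependentPairs⁺ bs b∈ Qbc)

    dependentPairs-unique : ∀ {bs} → Unique bs → Unique (dependentPairs bs)
    dependentPairs-unique []         = []
    dependentPairs-unique {b ∷ bs} (b∉ ∷ u) = Unique.++⁺
      (Unique.map⁺ (λ { refl → refl }) (unique (fibre b))) (dependentPairs-unique u) disjoint
      where
      disjoint : ∀ {bc} → ¬ (bc ∈ map (b ,_) (elements (fibre b)) × bc ∈ dependentPairs bs)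
      disjoint (∈b , ∈bs) with ∈-map⁻ (b ,_) ∈b
      ... | _ , _ , refl = All.lookup b∉ (proj₁ (∈-dependentPairs⁻ bs ∈bs)) refl

    pairs : ∀ {bs} → Unique bs → Finite (λ (b , c) → b ∈ bs × Q b c)
    pairs {bs} u = record
      { elements = dependentPairs bs
      ; unique   = dependentPairs-unique u
      ; sound    = ∈-dependentPairs⁻ bs
      ; complete = λ (b∈ , Qbc) → ∈-dependentPairs⁺ bs b∈ Qbc
      }

    ∑-dependentPairs : ∀ bs f → ∑ (dependentPairs bs) f ≡ ∑ bs λ b → ∑ᶠ (fibre b) λ c → f (b , c)
    ∑-dependentPairs []       f = refl
    ∑-dependentPairs (b ∷ bs) f = trans
      (∑-++ (map (b ,_) (elements (fibre b))) (dependentPairs bs) f)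
      (cong₂ _+_ (∑-map (b ,_) (elements (fibre b)) f) (∑-dependentPairs bs f))

    -- The common form of every double count below: the disc by norm, factor pairs by product or by
    -- first factor, solutions by their first coordinate, and the triples with t = 0 by the root d +
    -- i.
    ∑ᶠ-fibres : ∀ {A : Set} {P : Pred A 0ℓ} (p : Finite P) {bs} → Unique bs →
                (e : P ≅ λ (b , c) → b ∈ bs × Q b c) {f : A → ℤ} (g : B → C → ℤ) →
                (∀ {x} → P x → let b , c = _≅_.to e x in f x ≡ g b c) →
                ∑ᶠ p f ≡ ∑ bs λ b → ∑ᶠ (fibre b) (g b)
    ∑ᶠ-fibres p {bs} u e g eq = trans
      (∑ᶠ-≅ p (pairs u) e {g = λ (b , c) → g b c} eq)
      (∑-dependentPairs bs (λ (b , c) → g b c))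

  -- The character modulo 4

  χℕ : ℕ → ℤ
  χℕ 0 = 0ℤ
  χℕ 1 = 1ℤ
  χℕ 2 = 0ℤ
  χℕ 3 = -1ℤ
  χℕ (suc (suc (suc (suc n)))) = χℕ n

  -- The extension is odd because -1 ≡ 3 (mod 4), and so the period 4 persists across 0.
  χ : ℤ → ℤ
  χ (+ n)    = χℕ n
  χ -[1+ n ] = - χℕ (suc n)

  χ-neg : ∀ x → χ (- x) ≡ - χ x
  χ-neg +0       = refl
  χ-neg +[1+ n ] = refl
  χ-neg -[1+ n ] = sym (ℤ.neg-involutive (χℕ (suc n)))

  χ-+4 : ∀ x → χ (x + + 4) ≡ χ x
  χ-+4 (+ n)    = cong χℕ (ℕ.+-comm n 4)
  χ-+4 -[1+ 0 ] = refl
  χ-+4 -[1+ 1 ] = refl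
  χ-+4 -[1+ 2 ] = refl
  χ-+4 -[1+ 3 ] = refl
  χ-+4 -[1+ suc (suc (suc (suc n))) ] = refl

  χ-+4*ℕ : ∀ x k → χ (x + + 4 * + k) ≡ χ x
  χ-+4*ℕ x zero    = cong χ (ℤ.+-identityʳ x)
  χ-+4*ℕ x (suc k) = trans (cong χ (lemma x (+ k))) (trans (χ-+4 (x + + 4 * + k)) (χ-+4*ℕ x k))
    where
    lemma : ∀ x k → x + + 4 * (1ℤ + k) ≡ x + + 4 * k + + 4
    lemma = solve-∀

  χ-+4* : ∀ x k → χ (x + + 4 * k) ≡ χ x
  χ-+4* x (+ k)    = χ-+4*ℕ x k
  χ-+4* x -[1+ k ] = sym (trans (cong χ (lemma x +[1+ k ])) (χ-+4*ℕ (x - + 4 * +[1+ k ]) (suc k)))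
    where
    lemma : ∀ x k → x ≡ x + + 4 * - k + + 4 * k
    lemma = solve-∀

  -- The integers from 1 to m in descending order, so that passing to `suc m` adds its term at the
  -- head of the sum.
  range : ℕ → List ℤ
  range m = map +[1+_] (downFrom m)

  range-unique : ∀ m → Unique (range m)
  range-unique m = Unique.map⁺ (λ { refl → refl }) (Unique.downFrom⁺ m)

  ∈-range⁺ : ∀ {m z} → 0ℤ < z → z ≤ + m → z ∈ range m
  ∈-range⁺ {z = + suc j} _ (+≤+ j<m) = ∈-map⁺ +[1+_] (∈-downFrom⁺ j<m)
  ∈-range⁺ {z = +0} (+<+ ())

  ∈-range⁻ : ∀ {m z} → z ∈ range m → 0ℤ < z × z ≤ + m
  ∈-range⁻ z∈ with ∈-map⁻ +[1+_] z∈
  ... | j , j∈ , refl = +<+ (s≤s z≤n) , +≤+ (∈-downFrom⁻ j∈)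

  c : ℕ → ℤ
  c 0 = 0ℤ
  c 1 = 1ℤ
  c 2 = 1ℤ
  c 3 = 0ℤ
  c (suc (suc (suc (suc n)))) = c n

  ∑-range-χ : ∀ m → ∑ (range m) χ ≡ c m
  ∑-range-χ zero    = refl
  ∑-range-χ (suc m) = trans (+-congˡ (χℕ (suc m)) (∑-range-χ m)) (step m)
    where
    step : ∀ m → χℕ (suc m) + c m ≡ c (suc m)
    step 0 = refl
    step 1 = refl
    step 2 = refl
    step 3 = refl
    step (suc (suc (suc (suc m)))) = step m

  ∑-range-weighted : ℕ → ℤ
  ∑-range-weighted m = ∑ (range m) λ δ → (+ m - δ) * χ δ

  -- The new term δ = m + 1 has weight 0, and every earlier weight grows by 1, which adds χ(1) + ...
  -- + χ(m).
  ∑-range-weighted-suc : ∀ m → ∑-range-weighted (suc m) ≡ ∑-range-weighted m + c m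
  ∑-range-weighted-suc m = begin
    (+ suc m - + suc m) * χ (+ suc m) + ∑ (range m) (λ δ → (+ suc m - δ) * χ δ)
      ≡⟨ cong₂ _+_
           (cong (_* χ (+ suc m)) (ℤ.+-inverseʳ (+ suc m)))
           (∑-cong-∈ (range m) (λ {δ} _ → lemma (+ m) δ (χ δ))) ⟩
    0ℤ + ∑ (range m) (λ δ → (+ m - δ) * χ δ + χ δ)
      ≡⟨ ℤ.+-identityˡ _ ⟩
    ∑ (range m) (λ δ → (+ m - δ) * χ δ + χ δ)
      ≡⟨ ∑-+ (range m) (λ δ → (+ m - δ) * χ δ) χ ⟩
    ∑-range-weighted m + ∑ (range m) χ
      ≡⟨ +-congˡ (∑-range-weighted m) (∑-range-χ m) ⟩
    ∑-range-weighted m + c m ∎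
    where
    open ≡-Reasoning
    lemma : ∀ m δ x → (1ℤ + m - δ) * x ≡ (m - δ) * x + x
    lemma = solve-∀

  -- Two steps add c(2s) + c(2s + 1), which is 0 + 1 or 1 + 0 according to the parity of s. This
  -- evaluates the inner sum over the triples with t = 0.
  ∑-range-weighted-even : ∀ s → ∑-range-weighted (s ℕ.* 2) ≡ + s
  ∑-range-weighted-even zero    = refl
  ∑-range-weighted-even (suc s) = begin
    ∑-range-weighted (suc s ℕ.* 2)
      ≡⟨ ∑-range-weighted-suc (suc (s ℕ.* 2)) ⟩
    ∑-range-weighted (suc (s ℕ.* 2)) + c (suc (s ℕ.* 2))
      ≡⟨ cong (_+ c (suc (s ℕ.* 2))) (∑-range-weighted-suc (s ℕ.* 2)) ⟩
    ∑-range-weighted (s ℕ.* 2) + c (s ℕ.* 2) + c (suc (s ℕ.* 2))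
      ≡⟨ ℤ.+-assoc (∑-range-weighted (s ℕ.* 2)) _ _ ⟩
    ∑-range-weighted (s ℕ.* 2) + (c (s ℕ.* 2) + c (suc (s ℕ.* 2)))
      ≡⟨ cong₂ _+_ (∑-range-weighted-even s) (consecutive s) ⟩
    + s + 1ℤ
      ≡⟨ ℤ.+-comm (+ s) 1ℤ ⟩
    + suc s ∎
    where
    open ≡-Reasoning
    consecutive : ∀ s → c (s ℕ.* 2) + c (suc (s ℕ.* 2)) ≡ 1ℤ
    consecutive 0 = refl
    consecutive 1 = refl
    consecutive (suc (suc s)) = consecutive s

  -- Solution sets

  Divisions : ℤ → Pred (ℤ × ℤ) 0ℓ
  Divisions z (d , δ) = 0ℤ < d × 0ℤ < δ × d * δ ≡ z

  Circle : ℤ → Pred (ℤ × ℤ) 0ℓ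
  Circle z (x , y) = x * x + y * y ≡ z

  Sphere : ℕ → Pred (ℤ × ℤ × ℤ) 0ℓ
  Sphere n (x , y , z) = x * x + (y * y + z * z) ≡ + n

  Liouville : ℕ → Pred (ℤ × ℤ × ℤ) 0ℓ
  Liouville n (i , d , δ) = 0ℤ < d × 0ℤ < δ × i * i + d * δ ≡ + n

  Roots : ℕ → Pred ℤ 0ℓ
  Roots n x = x * x ≡ + n

  square : ∀ x → x * x ≡ + (∣ x ∣ ℕ.* ∣ x ∣)
  square x = trans (cong (x *_) (sym (ℤ.*-identityʳ x))) (square-abs x)

  divisions-bounded : ∀ {d δ} → 0ℤ < d → 0ℤ < δ →
                      ∣ d ∣ ℕ.≤ ∣ d ∣ ℕ.* ∣ δ ∣ × ∣ δ ∣ ℕ.≤ ∣ d ∣ ℕ.* ∣ δ ∣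
  divisions-bounded {+[1+ a ]} {+[1+ b ]} _ _ = ℕ.m≤m*n (suc a) (suc b) , ℕ.m≤n*m (suc b) (suc a)
  divisions-bounded {+0} (+<+ ())
  divisions-bounded {+[1+ a ]} {+0} _ (+<+ ())

  product-abs : ∀ {d δ} → 0ℤ < d → 0ℤ < δ → d * δ ≡ + (∣ d ∣ ℕ.* ∣ δ ∣)
  product-abs {+[1+ a ]} {+[1+ b ]} _ _ = refl
  product-abs {+0} (+<+ ())
  product-abs {+[1+ a ]} {+0} _ (+<+ ())

  intervals² : ∀ m → Unique (cartesianProduct (interval m) (interval m))
  intervals² m = Unique.cartesianProduct⁺ (interval-unique m) (interval-unique m)

  intervals³ : ∀ m → Unique (cartesianProduct (interval m) (cartesianProduct (interval m) (interval m)))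
  intervals³ m = Unique.cartesianProduct⁺ (interval-unique m) (intervals² m)

  ∈-intervals² : ∀ {m x y} → ∣ x ∣ ℕ.≤ m → ∣ y ∣ ℕ.≤ m →
                 (x , y) ∈ cartesianProduct (interval m) (interval m)
  ∈-intervals² x≤ y≤ = ∈-cartesianProduct⁺ (∈-interval _ x≤) (∈-interval _ y≤)

  divisions : ∀ z → Finite (Divisions z)
  divisions z = finite-dec
    (λ (d , δ) → (0ℤ ℤ.<? d) ×-dec ((0ℤ ℤ.<? δ) ×-dec (d * δ ℤ.≟ z)))
    _ (intervals² ∣ z ∣)
    λ (0<d , 0<δ , dδ≡z) →
      let d≤ , δ≤ = divisions-bounded 0<d 0<δ
          dδ = trans (cong ∣_∣ (sym (product-abs 0<d 0<δ))) (cong ∣_∣ dδ≡z)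
      in ∈-intervals² (subst (_ ℕ.≤_) dδ d≤) (subst (_ ℕ.≤_) dδ δ≤)

  circle-abs : ∀ {z x y} → Circle z (x , y) → + (∣ x ∣ ℕ.* ∣ x ∣ ℕ.+ ∣ y ∣ ℕ.* ∣ y ∣) ≡ z
  circle-abs {z} {x} {y} e = trans (sym (cong₂ _+_ (square x) (square y))) e

  circle : ∀ z → Finite (Circle z)
  circle z = finite-dec (λ (x , y) → x * x + y * y ℤ.≟ z) _ (intervals² ∣ z ∣)
    λ {(x , y)} e → ∈-intervals²
      (subst (_ ℕ.≤_) (cong ∣_∣ (circle-abs {z} {x} {y} e)) (ℕ.≤-trans (m≤m*m ∣ x ∣) (ℕ.m≤m+n _ _)))
      (subst (_ ℕ.≤_) (cong ∣_∣ (circle-abs {z} {x} {y} e)) (ℕ.≤-trans (m≤m*m ∣ y ∣) (ℕ.m≤n+m _ _)))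

  sphere-bounded : ∀ {n x y z} → Sphere n (x , y , z) → ∣ x ∣ ℕ.≤ n × ∣ y ∣ ℕ.≤ n × ∣ z ∣ ℕ.≤ n
  sphere-bounded {n} {x} {y} {z} e =
    ℕ.≤-trans (m≤m*m ∣ x ∣) (ℕ.≤-trans (ℕ.m≤m+n (∣ x ∣ ℕ.* ∣ x ∣) _) n≥) ,
    ℕ.≤-trans (m≤m*m ∣ y ∣) (ℕ.≤-trans (ℕ.m≤m+n (∣ y ∣ ℕ.* ∣ y ∣) _) yz≤) ,
    ℕ.≤-trans (m≤m*m ∣ z ∣) (ℕ.≤-trans (ℕ.m≤n+m (∣ z ∣ ℕ.* ∣ z ∣) _) yz≤)
    where
    n≥ : ∣ x ∣ ℕ.* ∣ x ∣ ℕ.+ (∣ y ∣ ℕ.* ∣ y ∣ ℕ.+ ∣ z ∣ ℕ.* ∣ z ∣) ℕ.≤ n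
    n≥ = ℕ.≤-reflexive (ℤ.+-injective
      (trans (sym (cong₂ _+_ (square x) (cong₂ _+_ (square y) (square z)))) e))
    yz≤ : ∣ y ∣ ℕ.* ∣ y ∣ ℕ.+ ∣ z ∣ ℕ.* ∣ z ∣ ℕ.≤ n
    yz≤ = ℕ.≤-trans (ℕ.m≤n+m _ (∣ x ∣ ℕ.* ∣ x ∣)) n≥

  sphere : ∀ n → Finite (Sphere n)
  sphere n = finite-dec (λ (x , y , z) → x * x + (y * y + z * z) ℤ.≟ + n) _ (intervals³ n)
    λ {(x , y , z)} e → let x≤ , y≤ , z≤ = sphere-bounded {n} {x} {y} {z} e in
      ∈-cartesianProduct⁺ (∈-interval x x≤) (∈-intervals² y≤ z≤)

  liouville-bounded : ∀ {n i d δ} → Liouville n (i , d , δ) → ∣ i ∣ ℕ.≤ n × ∣ d ∣ ℕ.≤ n × ∣ δ ∣ ℕ.≤ n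
  liouville-bounded {n} {i} {d} {δ} (0<d , 0<δ , e) =
    ℕ.≤-trans (m≤m*m ∣ i ∣) (ℕ.≤-trans (ℕ.m≤m+n _ _) n≥) ,
    ℕ.≤-trans (proj₁ bounds) (ℕ.≤-trans (ℕ.m≤n+m _ _) n≥) ,
    ℕ.≤-trans (proj₂ bounds) (ℕ.≤-trans (ℕ.m≤n+m _ _) n≥)
    where
    bounds = divisions-bounded 0<d 0<δ
    n≥ : ∣ i ∣ ℕ.* ∣ i ∣ ℕ.+ ∣ d ∣ ℕ.* ∣ δ ∣ ℕ.≤ n
    n≥ = ℕ.≤-reflexive (ℤ.+-injective
      (trans (sym (cong₂ _+_ (square i) (product-abs 0<d 0<δ))) e))

  liouville : ∀ n → Finite (Liouville n)
  liouville n = finite-dec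
    (λ (i , d , δ) → (0ℤ ℤ.<? d) ×-dec ((0ℤ ℤ.<? δ) ×-dec (i * i + d * δ ℤ.≟ + n)))
    _ (intervals³ n)
    λ {(i , d , δ)} p → let i≤ , d≤ , δ≤ = liouville-bounded {n} {i} {d} {δ} p in
      ∈-cartesianProduct⁺ (∈-interval i i≤) (∈-intervals² d≤ δ≤)

  root-bounded : ∀ {n x} → Roots n x → ∣ x ∣ ℕ.≤ n
  root-bounded {n} {x} e =
    subst (_ ℕ.≤_) (ℤ.+-injective (trans (sym (square x)) e)) (m≤m*m ∣ x ∣)

  roots : ∀ n → Finite (Roots n)
  roots n = finite-dec (λ x → x * x ℤ.≟ + n) (interval n) (interval-unique n)
    λ {x} e → ∈-interval x (root-bounded {n} {x} e)

  -- The sums over the sphere and over Liouville's set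

  ∑-sphere : ∀ n → ∑ᶠ (sphere n) (λ (x , _ , _) → + n - + 3 * (x * x)) ≡ 0ℤ
  ∑-sphere n = thrice (begin
    ∑ᶠ s fx + (∑ᶠ s fx + ∑ᶠ s fx)
      ≡⟨ +-congˡ (∑ᶠ s fx) (cong₂ _+_ ∑fx≡∑fy (trans ∑fx≡∑fy ∑fy≡∑fz)) ⟩
    ∑ᶠ s fx + (∑ᶠ s fy + ∑ᶠ s fz)
      ≡⟨ +-congˡ (∑ᶠ s fx) (∑ᶠ-+ s fy fz) ⟨
    ∑ᶠ s fx + ∑ᶠ s (λ p → fy p + fz p)
      ≡⟨ ∑ᶠ-+ s fx (λ p → fy p + fz p) ⟨
    ∑ᶠ s (λ p → fx p + (fy p + fz p))
      ≡⟨ ∑ᶠ-cong s (λ {(x , y , z)} e → trans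
           (lemma (+ n) x y z) (cong (λ r → + 3 * (+ n - r)) e)) ⟩
    ∑ᶠ s (λ _ → + 3 * (+ n - + n))
      ≡⟨ ∑ᶠ-*ˡ s (+ 3) (λ _ → + n - + n) ⟩
    + 3 * ∑ᶠ s (λ _ → + n - + n)
      ≡⟨ cong (+ 3 *_) (∑ᶠ-zero s (λ _ → ℤ.+-inverseʳ (+ n))) ⟩
    0ℤ ∎)
    where
    open ≡-Reasoning
    s = sphere n
    fx fy fz : ℤ × ℤ × ℤ → ℤ
    fx (x , _ , _) = + n - + 3 * (x * x)
    fy (_ , y , _) = + n - + 3 * (y * y)
    fz (_ , _ , z) = + n - + 3 * (z * z)
    ∑fx≡∑fy : ∑ᶠ s fx ≡ ∑ᶠ s fy
    ∑fx≡∑fy = ∑ᶠ-≅ s s (involution (λ (x , y , z) → y , x , z)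
      (λ {(x , y , z)} → trans (exchange x y z)) (λ _ → refl)) (λ _ → refl)
      where
      exchange : ∀ x y z → y * y + (x * x + z * z) ≡ x * x + (y * y + z * z)
      exchange = solve-∀
    ∑fy≡∑fz : ∑ᶠ s fy ≡ ∑ᶠ s fz
    ∑fy≡∑fz = ∑ᶠ-≅ s s (involution (λ (x , y , z) → x , z , y)
      (λ {(x , y , z)} → trans (exchange x y z)) (λ _ → refl)) (λ _ → refl)
      where
      exchange : ∀ x y z → x * x + (z * z + y * y) ≡ x * x + (y * y + z * z)
      exchange = solve-∀
    lemma : ∀ n x y z → n - + 3 * (x * x) + (n - + 3 * (y * y) + (n - + 3 * (z * z)))
                        ≡ + 3 * (n - (x * x + (y * y + z * z)))
    lemma = solve-∀
    thrice : ∀ {x} → x + (x + x) ≡ 0ℤ → x ≡ 0ℤ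
    thrice {+0} _ = refl

  module _ (n : ℕ) where

    S = liouville n

    -- H is G transported from t < 0 to t > 0, see ∑G-negative.
    t G H : ℤ × ℤ × ℤ → ℤ
    t (i , d , δ) = d + + 2 * i - δ
    G (i , d , δ) = (δ - + 2 * i) * (d + i) * χ δ
    H (i , d , δ) = (d + δ) * i * χ (t (i , d , δ))

    flip : Liouville n ≅ Liouville n
    flip = involution (λ (i , d , δ) → - i , d , δ)
      (λ {(i , d , δ)} (0<d , 0<δ , e) → 0<d , 0<δ , trans (lemma i d δ) e)
      (λ {(i , d , δ)} _ → cong (_, d , δ) (ℤ.neg-involutive i))
      where
      lemma : ∀ i d δ → - i * - i + d * δ ≡ i * i + d * δ
      lemma = solve-∀

    -- On the solution set n - 3i² = dδ - 2i² = (δ - 2i)(d + i) + i(2d - δ). The last summand is odd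
    -- in i, so its sum against χ(δ) vanishes under `flip`.
    ∑G : ∑ᶠ S (λ (i , d , δ) → (+ n - + 3 * (i * i)) * χ δ) ≡ ∑ᶠ S G
    ∑G = begin
      ∑ᶠ S (λ (i , d , δ) → (+ n - + 3 * (i * i)) * χ δ)
        ≡⟨ ∑ᶠ-cong S (λ {(i , d , δ)} (_ , _ , e) →
             trans (cong (λ m → (m - + 3 * (i * i)) * χ δ) (sym e)) (lemma i d δ (χ δ))) ⟩
      ∑ᶠ S (λ x → G x + odd x)  ≡⟨ ∑ᶠ-+ S G odd ⟩
      ∑ᶠ S G + ∑ᶠ S odd
        ≡⟨ +-congˡ (∑ᶠ S G) (∑ᶠ-antisymmetric S flip odd
             (λ {(i , d , δ)} _ → odd-flip i d δ (χ δ))) ⟩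
      ∑ᶠ S G + 0ℤ               ≡⟨ ℤ.+-identityʳ _ ⟩
      ∑ᶠ S G                    ∎
      where
      open ≡-Reasoning
      odd : ℤ × ℤ × ℤ → ℤ
      odd (i , d , δ) = i * (+ 2 * d - δ) * χ δ
      lemma : ∀ i d δ x → (i * i + d * δ - + 3 * (i * i)) * x
                          ≡ (δ - + 2 * i) * (d + i) * x + i * (+ 2 * d - δ) * x
      lemma = solve-∀
      odd-flip : ∀ i d δ x → - i * (+ 2 * d - δ) * x ≡ - (i * (+ 2 * d - δ) * x)
      odd-flip = solve-∀

    -- The involution exchanges the values of d and t, so the conditions d > 0 and t > 0 swap. It
    -- fixes δ and d + i and negates δ - 2i.
    ∑G-positive : ∑ᶠ (onPositive S t) G ≡ 0ℤ
    ∑G-positive = ∑ᶠ-antisymmetric (onPositive S t)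
      (involution (λ (i , d , δ) → δ - i , t (i , d , δ) , δ)
        (λ {(i , d , δ)} ((0<d , 0<δ , e) , 0<t) →
          (0<t , 0<δ , trans (norm i d δ) e) , subst (0ℤ <_) (t-image i d δ) 0<d)
        (λ {(i , d , δ)} _ → cong₂ _,_ (i-twice i δ) (cong (_, δ) (sym (t-image i d δ)))))
      G (λ {(i , d , δ)} _ → anti i d δ (χ δ))
      where
      norm : ∀ i d δ → (δ - i) * (δ - i) + (d + + 2 * i - δ) * δ ≡ i * i + d * δ
      norm = solve-∀
      t-image : ∀ i d δ → d ≡ (d + + 2 * i - δ) + + 2 * (δ - i) - δ
      t-image = solve-∀
      i-twice : ∀ i δ → δ - (δ - i) ≡ i
      i-twice = solve-∀
      anti : ∀ i d δ x → (δ - + 2 * (δ - i)) * ((d + + 2 * i - δ) + (δ - i)) * x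
                         ≡ - ((δ - + 2 * i) * (d + i) * x)
      anti = solve-∀

    -- The image of (i, d, δ) has entries -t and d, and its own t is the old δ. Hence t < 0 and δ >
    -- 0 become positivity of the first factor and of the new t, and χ(δ) becomes χ of the new t.
    -- The factor δ - 2i is -t + d, the sum of the new factors.
    ∑G-negative : ∑ᶠ (onNegative S t) G ≡ ∑ᶠ (onPositive S t) H
    ∑G-negative = ∑ᶠ-≅ (onNegative S t) (onPositive S t) (record
      { to      = λ (i , d , δ) → i + d , - t (i , d , δ) , d
      ; from    = λ (i , d , δ) → i - δ , δ , t (i , d , δ)
      ; to-∈    = λ {(i , d , δ)} ((0<d , 0<δ , e) , t<0) →
          (ℤ.neg-mono-< t<0 , 0<d , trans (norm-to i d δ) e) , subst (0ℤ <_) (t-to i d δ) 0<δ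
      ; from-∈  = λ {(i , d , δ)} ((0<d , 0<δ , e) , 0<t) →
          (0<δ , 0<t , trans (norm-from i d δ) e) , subst (_< 0ℤ) (t-from i d δ) (ℤ.neg-mono-< 0<d)
      ; from-to = λ {(i , d , δ)} _ → cong₂ _,_ (cancel i d) (cong (d ,_) (sym (t-to i d δ)))
      ; to-from = λ {(i , d , δ)} _ → cong₂ _,_ (cancel′ i δ)
          (cong (_, δ) (trans (cong -_ (sym (t-from i d δ))) (ℤ.neg-involutive d)))
      })
      (λ {(i , d , δ)} _ → trans
        (value i d δ (χ δ)) (cong (λ z → (- t (i , d , δ) + d) * (i + d) * χ z) (t-to i d δ)))
      where
      norm-to : ∀ i d δ → (i + d) * (i + d) + - (d + + 2 * i - δ) * d ≡ i * i + d * δ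
      norm-to = solve-∀
      norm-from : ∀ i d δ → (i - δ) * (i - δ) + δ * (d + + 2 * i - δ) ≡ i * i + d * δ
      norm-from = solve-∀
      t-to : ∀ i d δ → δ ≡ - (d + + 2 * i - δ) + + 2 * (i + d) - d
      t-to = solve-∀
      t-from : ∀ i d δ → - d ≡ δ + + 2 * (i - δ) - (d + + 2 * i - δ)
      t-from = solve-∀
      cancel : ∀ i d → i + d - d ≡ i
      cancel = solve-∀
      cancel′ : ∀ i d → i - d + d ≡ i
      cancel′ = solve-∀
      value : ∀ i d δ x → (δ - + 2 * i) * (d + i) * x ≡ (- (d + + 2 * i - δ) + d) * (i + d) * x
      value = solve-∀

    -- Exchanging d and δ keeps (d + δ) i and sends t to -t + 4i, where χ takes the value -χ(t).
    ∑H : ∑ᶠ S H ≡ 0ℤ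
    ∑H = ∑ᶠ-antisymmetric S exchange H λ {(i , d , δ)} _ → begin
      (δ + d) * i * χ (δ + + 2 * i - d)
        ≡⟨ cong (λ z → (δ + d) * i * χ z) (shift i d δ) ⟩
      (δ + d) * i * χ (- t (i , d , δ) + + 4 * i)
        ≡⟨ cong ((δ + d) * i *_) (trans (χ-+4* (- t (i , d , δ)) i) (χ-neg (t (i , d , δ)))) ⟩
      (δ + d) * i * - χ (t (i , d , δ))
        ≡⟨ lemma i d δ _ ⟩
      - H (i , d , δ) ∎
      where
      open ≡-Reasoning
      exchange : Liouville n ≅ Liouville n
      exchange = involution (λ (i , d , δ) → i , δ , d)
        (λ {(i , d , δ)} (0<d , 0<δ , e) → 0<δ , 0<d , trans (+-congˡ (i * i) (ℤ.*-comm δ d)) e)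
        (λ _ → refl)
      shift : ∀ i d δ → δ + + 2 * i - d ≡ - (d + + 2 * i - δ) + + 4 * i
      shift = solve-∀
      lemma : ∀ i d δ x → (δ + d) * i * - x ≡ - ((d + δ) * i * x)
      lemma = solve-∀

    ∑H-zero : ∑ᶠ (onZero S t) H ≡ 0ℤ
    ∑H-zero = ∑ᶠ-zero (onZero S t) λ {(i , d , δ)} (_ , t≡0) → trans
      (cong (λ z → (d + δ) * i * χ z) t≡0)
      (ℤ.*-zeroʳ ((d + δ) * i))

    -- Exchanging d and δ and also negating i sends t to -t. Both i and χ(t) change sign, so H is
    -- preserved.
    ∑H-positive≡∑H-negative : ∑ᶠ (onPositive S t) H ≡ ∑ᶠ (onNegative S t) H
    ∑H-positive≡∑H-negative = ∑ᶠ-≅ (onPositive S t) (onNegative S t) (record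
      { to      = turn
      ; from    = turn
      ; to-∈    = λ {x} (Sx , 0<t) → turn-∈ {x} Sx , subst (_< 0ℤ) (t-turn x) (ℤ.neg-mono-< 0<t)
      ; from-∈  = λ {x} (Sx , t<0) → turn-∈ {x} Sx , subst (0ℤ <_) (t-turn x) (ℤ.neg-mono-< t<0)
      ; from-to = λ {(i , d , δ)} _ → cong (_, d , δ) (ℤ.neg-involutive i)
      ; to-from = λ {(i , d , δ)} _ → cong (_, d , δ) (ℤ.neg-involutive i)
      })
      λ {(i , d , δ)} _ → trans
        (value i d δ (χ (t (i , d , δ))))
        (cong ((δ + d) * - i *_) (trans (sym (χ-neg (t (i , d , δ)))) (cong χ (t-turn (i , d , δ)))))
      where
      turn : ℤ × ℤ × ℤ → ℤ × ℤ × ℤ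
      turn (i , d , δ) = - i , δ , d
      turn-∈ : ∀ {x} → Liouville n x → Liouville n (turn x)
      turn-∈ {i , d , δ} (0<d , 0<δ , e) = 0<δ , 0<d , trans (lemma i d δ) e
        where
        lemma : ∀ i d δ → - i * - i + δ * d ≡ i * i + d * δ
        lemma = solve-∀
      t-turn : ∀ x → - t x ≡ t (turn x)
      t-turn (i , d , δ) = lemma i d δ
        where
        lemma : ∀ i d δ → - (d + + 2 * i - δ) ≡ δ + + 2 * - i - d
        lemma = solve-∀
      value : ∀ i d δ x → (d + δ) * i * x ≡ (δ + d) * - i * - x
      value = solve-∀

    -- The whole sum is 0, the part with t = 0 is 0 because χ(0) = 0, and the two remaining parts
    -- are equal.
    ∑H-positive : ∑ᶠ (onPositive S t) H ≡ 0ℤ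
    ∑H-positive = twice (begin
      ∑H₊ + ∑H₊
        ≡⟨ +-congˡ ∑H₊ (trans ∑H-positive≡∑H-negative (sym (ℤ.+-identityˡ _))) ⟩
      ∑H₊ + (0ℤ + ∑ᶠ (onNegative S t) H)
        ≡⟨ cong (λ z → ∑H₊ + (z + ∑ᶠ (onNegative S t) H)) ∑H-zero ⟨
      ∑H₊ + (∑ᶠ (onZero S t) H + ∑ᶠ (onNegative S t) H)
        ≡⟨ ∑ᶠ-signs S t H ⟨
      ∑ᶠ S H
        ≡⟨ ∑H ⟩
      0ℤ ∎)
      where
      open ≡-Reasoning
      ∑H₊ = ∑ᶠ (onPositive S t) H
      twice : ∀ {x} → x + x ≡ 0ℤ → x ≡ 0ℤ
      twice {+0} _ = refl

    ∑G≡∑G-zero : ∑ᶠ S G ≡ ∑ᶠ (onZero S t) G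
    ∑G≡∑G-zero = begin
      ∑ᶠ S G
        ≡⟨ ∑ᶠ-signs S t G ⟩
      ∑ᶠ (onPositive S t) G + (∑ᶠ (onZero S t) G + ∑ᶠ (onNegative S t) G)
        ≡⟨ cong₂ _+_ ∑G-positive (+-congˡ (∑ᶠ (onZero S t) G) (trans ∑G-negative ∑H-positive)) ⟩
      0ℤ + (∑ᶠ (onZero S t) G + 0ℤ)
        ≡⟨ trans (ℤ.+-identityˡ _) (ℤ.+-identityʳ _) ⟩
      ∑ᶠ (onZero S t) G ∎
      where open ≡-Reasoning

  -- The triples with t = 0 and the square roots of n

  enumerated : {xs : List A} → Unique xs → Finite (_∈ xs)
  enumerated {xs = xs} u = record { elements = xs ; unique = u ; sound = id ; complete = id }

  i<j⇒0<j-i : ∀ {i j} → i < j → 0ℤ < j - i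
  i<j⇒0<j-i {i} {j} i<j = subst (_< j - i) (ℤ.+-inverseʳ i) (ℤ.+-monoˡ-< (- i) i<j)

  pos-double : ∀ s → 0ℤ < s → + (∣ s ∣ ℕ.* 2) ≡ s * + 2
  pos-double (+ k) _ = ℤ.pos-* k 2

  half-positive : ∀ s → 0ℤ < s * + 2 → 0ℤ < s
  half-positive +[1+ k ] _ = +<+ (s≤s z≤n)
  half-positive +0 (+<+ ())

  ∈-range-pred⁺ : ∀ {m z} → 0ℤ < z → z < + m → z ∈ range (ℕ.pred m)
  ∈-range-pred⁺ {suc m} 0<z (+<+ (s≤s z≤m)) = ∈-range⁺ 0<z (+≤+ z≤m)

  ∈-range-pred⁻ : ∀ {m z} → z ∈ range (ℕ.pred m) → 0ℤ < z × z < + m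
  ∈-range-pred⁻ {suc m} z∈ with ∈-range⁻ {m} z∈
  ... | 0<z , +≤+ z≤m = 0<z , +<+ (s≤s z≤m)

  -- The range ends at 2s - 1 because d = 2s - δ must be positive. The term δ = 2s has weight 0 and
  -- may be added, which gives `∑-range-weighted` at an even argument.
  ∑-range-pred-weighted : ∀ s → 0ℤ < s →
    ∑ (range (ℕ.pred (∣ s ∣ ℕ.* 2))) (λ δ → (+ (∣ s ∣ ℕ.* 2) - δ) * χ δ) ≡ s
  ∑-range-pred-weighted +0 (+<+ ())
  ∑-range-pred-weighted +[1+ k ] _ = begin
    X                        ≡⟨ ℤ.+-identityˡ X ⟨
    0ℤ + X                   ≡⟨ cong (λ z → z * χ M + X) (ℤ.+-inverseʳ M) ⟨
    (M - M) * χ M + X        ≡⟨⟩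
    ∑-range-weighted (suc k ℕ.* 2) ≡⟨ ∑-range-weighted-even (suc k) ⟩
    +[1+ k ]                 ∎
    where
    open ≡-Reasoning
    M = + (suc k ℕ.* 2)
    X = ∑ (range (suc (k ℕ.* 2))) (λ δ → (M - δ) * χ δ)

  module _ (n : ℕ) where

    positiveRoots : Finite (Roots n ∩ (0ℤ <_))
    positiveRoots = onPositive (roots n) id

    -- This is 1 if n is a nonzero square and 0 otherwise.
    q : ℤ
    q = ∑ᶠ positiveRoots λ _ → 1ℤ

    -- With s = d + i, the condition t = 0 reads d + δ = 2s, and s² = i² + dδ + dt = n. Conversely s
    -- and δ determine d = 2s - δ and i = δ - s, and d > 0 bounds δ by 2s - 1.
    boundary : (Liouville n ∩ λ x → t n x ≡ 0ℤ) ≅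
               (λ (s , δ) → s ∈ Finite.elements positiveRoots × δ ∈ range (ℕ.pred (∣ s ∣ ℕ.* 2)))
    boundary = record
      { to      = λ (i , d , δ) → d + i , δ
      ; from    = λ (s , δ) → δ - s , s * + 2 - δ , δ
      ; to-∈    = λ {(i , d , δ)} → to-∈ i d δ
      ; from-∈  = λ {(s , δ)} → from-∈ s δ
      ; from-to = λ {(i , d , δ)} (_ , t≡0) → cong₂ _,_
          (trans (recover-i i d δ) (trans (cong (λ z → i - z) t≡0) (ℤ.+-identityʳ i)))
          (cong (_, δ) (trans (recover-d i d δ) (trans (cong (λ z → d + z) t≡0) (ℤ.+-identityʳ d))))
      ; to-from = λ {(s , δ)} _ → cong (_, δ) (recover-s s δ)
      }
      where
      recover-i : ∀ i d δ → δ - (d + i) ≡ i - (d + + 2 * i - δ)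
      recover-i = solve-∀
      recover-d : ∀ i d δ → (d + i) * + 2 - δ ≡ d + (d + + 2 * i - δ)
      recover-d = solve-∀
      recover-s : ∀ s δ → s * + 2 - δ + (δ - s) ≡ s
      recover-s = solve-∀
      to-∈ : ∀ i d δ → (Liouville n ∩ λ x → t n x ≡ 0ℤ) (i , d , δ) →
             d + i ∈ Finite.elements positiveRoots × δ ∈ range (ℕ.pred (∣ d + i ∣ ℕ.* 2))
      to-∈ i d δ ((0<d , 0<δ , e) , t≡0) =
        Finite.complete positiveRoots (root , 0<s) ,
        ∈-range-pred⁺ 0<δ (subst (δ <_) (sym (trans (pos-double (d + i) 0<s) double))
          (subst (_< δ + d) (ℤ.+-identityʳ δ) (ℤ.+-monoʳ-< δ 0<d)))
        where
        double-t : ∀ i d δ → (d + i) * + 2 ≡ δ + d + (d + + 2 * i - δ)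
        double-t = solve-∀
        double : (d + i) * + 2 ≡ δ + d
        double = trans (double-t i d δ) (trans (cong (λ z → δ + d + z) t≡0) (ℤ.+-identityʳ _))
        0<s : 0ℤ < d + i
        0<s = half-positive (d + i) (subst (0ℤ <_) (sym double) (ℤ.+-mono-< 0<δ 0<d))
        root-t : ∀ i d δ → (d + i) * (d + i) ≡ i * i + d * δ + d * (d + + 2 * i - δ)
        root-t = solve-∀
        root : (d + i) * (d + i) ≡ + n
        root = trans (root-t i d δ) (trans
          (cong₂ _+_ e (trans (cong (d *_) t≡0) (ℤ.*-zeroʳ d))) (ℤ.+-identityʳ (+ n)))
      from-∈ : ∀ s δ → s ∈ Finite.elements positiveRoots × δ ∈ range (ℕ.pred (∣ s ∣ ℕ.* 2)) →
               (Liouville n ∩ λ x → t n x ≡ 0ℤ) (δ - s , s * + 2 - δ , δ)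
      from-∈ s δ (s∈ , δ∈) =
        (i<j⇒0<j-i (subst (δ <_) (pos-double s 0<s) δ<) , 0<δ , trans (norm s δ) root) , t-zero s δ
        where
        root = proj₁ (Finite.sound positiveRoots s∈)
        0<s  = proj₂ (Finite.sound positiveRoots s∈)
        0<δ  = proj₁ (∈-range-pred⁻ {∣ s ∣ ℕ.* 2} δ∈)
        δ<   = proj₂ (∈-range-pred⁻ {∣ s ∣ ℕ.* 2} δ∈)
        norm : ∀ s δ → (δ - s) * (δ - s) + (s * + 2 - δ) * δ ≡ s * s
        norm = solve-∀
        t-zero : ∀ s δ → s * + 2 - δ + + 2 * (δ - s) - δ ≡ 0ℤ
        t-zero = solve-∀

    -- Where t = 0, δ - 2i = d = 2s - δ, so G = s (2s - δ) χ(δ). Summing over δ gives s · s = n for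
    -- each positive root s.
    ∑G-zero : ∑ᶠ (onZero (liouville n) (t n)) (G n) ≡ + n * q
    ∑G-zero = begin
      ∑ᶠ (onZero (liouville n) (t n)) (G n)
        ≡⟨ ∑ᶠ-fibres fibre (onZero (liouville n) (t n)) (Finite.unique positiveRoots) boundary
             (λ s δ → s * ((+ (∣ s ∣ ℕ.* 2) - δ) * χ δ))
             (λ {(i , d , δ)} x∈ → trans (value i d δ (proj₂ x∈)) (cong
                (λ m → (d + i) * ((m - δ) * χ δ))
                (sym (pos-double (d + i) (proj₂ (Finite.sound positiveRoots
                  (proj₁ (_≅_.to-∈ boundary {i , d , δ} x∈)))))))) ⟩
      ∑ᶠ positiveRoots (λ s → ∑ᶠ (fibre s) (λ δ → s * ((+ (∣ s ∣ ℕ.* 2) - δ) * χ δ)))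
        ≡⟨ ∑ᶠ-cong positiveRoots (λ {s} (root , 0<s) → trans
             (∑ᶠ-*ˡ (fibre s) s (λ δ → (+ (∣ s ∣ ℕ.* 2) - δ) * χ δ))
             (trans (cong (s *_) (∑-range-pred-weighted s 0<s))
               (trans root (sym (ℤ.*-identityʳ (+ n)))))) ⟩
      ∑ᶠ positiveRoots (λ _ → + n * 1ℤ)
        ≡⟨ ∑ᶠ-*ˡ positiveRoots (+ n) (λ _ → 1ℤ) ⟩
      + n * q ∎
      where
      open ≡-Reasoning
      fibre : ∀ s → Finite (_∈ range (ℕ.pred (∣ s ∣ ℕ.* 2)))
      fibre s = enumerated (range-unique (ℕ.pred (∣ s ∣ ℕ.* 2)))
      value : ∀ i d δ → t n (i , d , δ) ≡ 0ℤ →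
              G n (i , d , δ) ≡ (d + i) * (((d + i) * + 2 - δ) * χ δ)
      value i d δ t≡0 = trans (lemma i d δ (χ δ)) (trans
        (cong (λ z → (d + i) * (((d + i) * + 2 - δ - + 2 * z) * χ δ)) t≡0)
        (cong (λ z → (d + i) * (z * χ δ)) (ℤ.+-identityʳ ((d + i) * + 2 - δ))))
        where
        lemma : ∀ i d δ x → (δ - + 2 * i) * (d + i) * x
                ≡ (d + i) * (((d + i) * + 2 - δ - + 2 * (d + + 2 * i - δ)) * x)
        lemma = solve-∀

    w : ℤ → ℤ
    w i = + n - + 3 * (i * i)

    ∑-liouville : ∑ᶠ (liouville n) (λ (i , d , δ) → w i * χ δ) ≡ + n * q
    ∑-liouville = trans (∑G n) (trans (∑G≡∑G-zero n) ∑G-zero)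

    -- At a root the weight is n - 3n = -2n, and negation matches the negative roots with the
    -- positive ones.
    ∑-roots : ∑ᶠ (roots n) w ≡ - (+ 4) * (+ n * q)
    ∑-roots = begin
      ∑ᶠ (roots n) w
        ≡⟨ ∑ᶠ-cong (roots n) (λ {i} e → trans
             (cong (λ m → m - + 3 * (i * i)) (sym e)) (trans (lemma (i * i)) (cong (- (+ 2) *_) e))) ⟩
      ∑ᶠ (roots n) f
        ≡⟨ ∑ᶠ-signs (roots n) id f ⟩
      ∑ᶠ positiveRoots f + (∑ᶠ (onZero (roots n) id) f + ∑ᶠ (onNegative (roots n) id) f)
        ≡⟨ +-congˡ (∑ᶠ positiveRoots f) (cong₂ _+_
             -- The root 0 forces n = 0, and then the constant -2n is 0.
             (∑ᶠ-zero (onZero (roots n) id) (λ { (e , refl) → cong (- (+ 2) *_) (sym e) }))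
             (∑ᶠ-≅ (onNegative (roots n) id) positiveRoots (record
               { to      = -_
               ; from    = -_
               ; to-∈    = λ {i} (e , i<0) → trans (square-neg i) e , ℤ.neg-mono-< i<0
               ; from-∈  = λ {i} (e , 0<i) → trans (square-neg i) e , ℤ.neg-mono-< 0<i
               ; from-to = λ {i} _ → ℤ.neg-involutive i
               ; to-from = λ {i} _ → ℤ.neg-involutive i
               }) {f} {f} (λ _ → refl))) ⟩
      ∑ᶠ positiveRoots f + (0ℤ + ∑ᶠ positiveRoots f)
        ≡⟨ cong (λ z → z + (0ℤ + z)) (trans
             (∑ᶠ-cong positiveRoots (λ _ → sym (ℤ.*-identityʳ (- (+ 2) * + n))))
             (∑ᶠ-*ˡ positiveRoots (- (+ 2) * + n) (λ _ → 1ℤ))) ⟩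
      - (+ 2) * + n * q + (0ℤ + - (+ 2) * + n * q)
        ≡⟨ total (+ n) q ⟩
      - (+ 4) * (+ n * q) ∎
      where
      open ≡-Reasoning
      f : ℤ → ℤ
      f _ = - (+ 2) * + n
      lemma : ∀ m → m - + 3 * m ≡ - (+ 2) * m
      lemma = solve-∀
      square-neg : ∀ i → - i * - i ≡ i * i
      square-neg = solve-∀
      total : ∀ n q → - (+ 2) * n * q + (0ℤ + - (+ 2) * n * q) ≡ - (+ 4) * (n * q)
      total = solve-∀

  -- Jacobi's two-square theorem

  r₂ : ℤ → ℤ
  r₂ z = ∑ᶠ (circle z) λ _ → 1ℤ

  E : ℤ → ℤ
  E z = ∑ᶠ (divisions z) λ (_ , δ) → χ δ

  -- Corrects for r₂ 0 = 1 while E 0 = 0.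
  ι : ℤ → ℤ
  ι (+ zero)  = 1ℤ
  ι +[1+ _ ]  = 0ℤ
  ι -[1+ _ ]  = 0ℤ

  -- Fixing the first coordinate i in an equation i² + ... = n leaves the same problem for n - i².
  -- This turns sums over the sphere and over Liouville's set into recurrences for `r₂` and `E`.
  ∑ᶠ-slices : ∀ n {C : Set} {P : Pred (ℤ × C) 0ℓ} {Q : ℤ → Pred C 0ℓ}
              (p : Finite P) (fibre : ∀ z → Finite (Q z)) →
              (∀ {i c} → P (i , c) → ∣ i ∣ ℕ.≤ n) →
              (∀ {i c} → P (i , c) → Q (+ n - i * i) c) →
              (∀ {i c} → Q (+ n - i * i) c → P (i , c)) →
              ∀ (v : ℤ → ℤ) (h : C → ℤ) →
              ∑ᶠ p (λ (i , c) → v i * h c) ≡ ∑ (interval n) λ i → v i * ∑ᶠ (fibre (+ n - i * i)) h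
  ∑ᶠ-slices n p fibre bound P⇒Q Q⇒P v h = trans
    (∑ᶠ-fibres (λ i → fibre (+ n - i * i)) p (interval-unique n) (identity
      (λ {(i , c)} Px → ∈-interval i (bound Px) , P⇒Q Px)
      (λ {(i , c)} (_ , Qx) → Q⇒P Qx)) (λ i c → v i * h c) (λ _ → refl))
    (∑-cong-∈ (interval n) λ {i} _ → ∑ᶠ-*ˡ (fibre (+ n - i * i)) (v i) h)

  +≡⇒≡- : ∀ a {b c} → a + b ≡ c → b ≡ c - a
  +≡⇒≡- a {b} refl = lemma a b
    where
    lemma : ∀ a b → b ≡ a + b - a
    lemma = solve-∀

  ≡-⇒+≡ : ∀ a {b} c → b ≡ c - a → a + b ≡ c
  ≡-⇒+≡ a c refl = lemma a c
    where
    lemma : ∀ a c → a + (c - a) ≡ c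
    lemma = solve-∀

  -- Jacobi's theorem says that this vanishes. The subtractions are written as multiples by
  -- constants so that sums distribute by `∑-*ˡ`.
  jacobiDefect : ℤ → ℤ
  jacobiDefect z = r₂ z + (- (+ 4) * E z + -1ℤ * ι z)

  module _ (n : ℕ) where

    ∑-w*r₂ : ∑ (interval n) (λ i → w n i * r₂ (+ n - i * i)) ≡ 0ℤ
    ∑-w*r₂ = begin
      ∑ (interval n) (λ i → w n i * r₂ (+ n - i * i))
        ≡⟨ ∑ᶠ-slices n (sphere n) circle
             (λ {i} {c} e → proj₁ (sphere-bounded {n} {i} {proj₁ c} {proj₂ c} e))
             (λ {i} e → +≡⇒≡- (i * i) e) (λ {i} e → ≡-⇒+≡ (i * i) (+ n) e) (w n) (λ _ → 1ℤ) ⟨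
      ∑ᶠ (sphere n) (λ (i , _) → w n i * 1ℤ)
        ≡⟨ ∑ᶠ-cong (sphere n) (λ {(i , _)} _ → ℤ.*-identityʳ (w n i)) ⟩
      ∑ᶠ (sphere n) (λ (i , _) → w n i)
        ≡⟨ ∑-sphere n ⟩
      0ℤ ∎
      where open ≡-Reasoning

    ∑-w*E : ∑ (interval n) (λ i → w n i * E (+ n - i * i)) ≡ + n * q n
    ∑-w*E = trans
      (sym (∑ᶠ-slices n (liouville n) divisions
        (λ {i} {c} x∈ → proj₁ (liouville-bounded {n} {i} {proj₁ c} {proj₂ c} x∈))
        (λ {i} (0<d , 0<δ , e) → 0<d , 0<δ , +≡⇒≡- (i * i) e)
        (λ {i} (0<d , 0<δ , e) → 0<d , 0<δ , ≡-⇒+≡ (i * i) (+ n) e)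
        (w n) (λ (_ , δ) → χ δ)))
      (∑-liouville n)

    -- The factor `ι (+ n - i * i)` selects exactly the i with i² = n.
    ∑-w*ι : ∑ (interval n) (λ i → w n i * ι (+ n - i * i)) ≡ - (+ 4) * (+ n * q n)
    ∑-w*ι = begin
      ∑ (interval n) f
        ≡⟨ ∑-filter root? (interval n) f ⟩
      ∑ᶠ (roots n) f + ∑ (filter (¬? ∘ root?) (interval n)) f
        ≡⟨ cong₂ _+_
             (∑ᶠ-cong (roots n) (λ {i} e → trans
               (cong (λ z → w n i * ι z) (ℤ.i≡j⇒i-j≡0 (sym e))) (ℤ.*-identityʳ (w n i))))
             (∑-zero-∈ (filter (¬? ∘ root?) (interval n)) (λ {i} i∈ → trans
               (cong (w n i *_) (ι-nonzero (proj₂ (∈-filter⁻ (¬? ∘ root?) {xs = interval n} i∈)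
                                 ∘ sym ∘ ℤ.i-j≡0⇒i≡j (+ n) (i * i))))
               (ℤ.*-zeroʳ (w n i)))) ⟩
      ∑ᶠ (roots n) (w n) + 0ℤ
        ≡⟨ ℤ.+-identityʳ _ ⟩
      ∑ᶠ (roots n) (w n)
        ≡⟨ ∑-roots n ⟩
      - (+ 4) * (+ n * q n) ∎
      where
      open ≡-Reasoning
      f : ℤ → ℤ
      f i = w n i * ι (+ n - i * i)
      root? : Decidable (Roots n)
      root? x = x * x ℤ.≟ + n
      ι-nonzero : ∀ {z} → z ≢ 0ℤ → ι z ≡ 0ℤ
      ι-nonzero {+0} z≢0 = ⊥-elim (z≢0 refl)
      ι-nonzero {+[1+ _ ]} _ = refl
      ι-nonzero { -[1+ _ ]} _ = refl

    -- The sphere contributes 0. The term -4nq from -4 `E` cancels the term from -`ι`, whose sum is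
    -- -4nq.
    ∑-w*jacobiDefect : ∑ (interval n) (λ i → w n i * jacobiDefect (+ n - i * i)) ≡ 0ℤ
    ∑-w*jacobiDefect = begin
      ∑ (interval n) (λ i → w n i * jacobiDefect (+ n - i * i))
        ≡⟨ ∑-cong-∈ (interval n) (λ {i} _ →
             let z = + n - i * i in distribute (w n i) (r₂ z) (E z) (ι z)) ⟩
      ∑ (interval n) (λ i → wr i + (- (+ 4) * wE i + -1ℤ * wι i))
        ≡⟨ ∑-+ (interval n) wr (λ i → - (+ 4) * wE i + -1ℤ * wι i) ⟩
      ∑ (interval n) wr + ∑ (interval n) (λ i → - (+ 4) * wE i + -1ℤ * wι i)
        ≡⟨ cong₂ _+_ ∑-w*r₂ (∑-+ (interval n) (λ i → - (+ 4) * wE i) (λ i → -1ℤ * wι i)) ⟩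
      0ℤ + (∑ (interval n) (λ i → - (+ 4) * wE i) + ∑ (interval n) (λ i → -1ℤ * wι i))
        ≡⟨ cong (λ z → 0ℤ + z) (cong₂ _+_
             (trans (∑-*ˡ (interval n) (- (+ 4)) wE) (cong (- (+ 4) *_) ∑-w*E))
             (trans (∑-*ˡ (interval n) -1ℤ wι) (cong (-1ℤ *_) ∑-w*ι))) ⟩
      0ℤ + (- (+ 4) * (+ n * q n) + -1ℤ * (- (+ 4) * (+ n * q n)))
        ≡⟨ cancel (+ n * q n) ⟩
      0ℤ ∎
      where
      open ≡-Reasoning
      wr wE wι : ℤ → ℤ
      wr i = w n i * r₂ (+ n - i * i)
      wE i = w n i * E (+ n - i * i)
      wι i = w n i * ι (+ n - i * i)
      distribute : ∀ w r e o → w * (r + (- (+ 4) * e + -1ℤ * o))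
                               ≡ w * r + (- (+ 4) * (w * e) + -1ℤ * (w * o))
      distribute = solve-∀
      cancel : ∀ x → 0ℤ + (- (+ 4) * x + -1ℤ * (- (+ 4) * x)) ≡ 0ℤ
      cancel = solve-∀

  -- The recurrence runs over all |i| ≤ n and so reaches negative arguments n - i², where there are
  -- neither sums of two squares nor positive factorisations.
  jacobiDefect-negative : ∀ k → jacobiDefect -[1+ k ] ≡ 0ℤ
  jacobiDefect-negative k = cong₂ _+_
    (∑ᶠ-zero (circle -[1+ k ]) (λ {(x , y)} e → impossible (circle-abs { -[1+ k ]} {x} {y} e)))
    (cong (λ z → - (+ 4) * z + 0ℤ) (∑ᶠ-zero (divisions -[1+ k ]) λ {(d , δ)} (0<d , 0<δ , e) →
      impossible (trans (sym (product-abs 0<d 0<δ)) e)))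
    where
    impossible : ∀ {m} {A : Set} → + m ≡ -[1+ k ] → A
    impossible ()

  square-positive : ∀ {i} → i ≢ 0ℤ → Σ ℕ λ m → i * i ≡ +[1+ m ]
  square-positive {+0} i≢0 = ⊥-elim (i≢0 refl)
  square-positive {+[1+ k ]} _ = _ , refl
  square-positive { -[1+ k ]} _ = _ , refl

  -- Strong induction: in the recurrence the term i = 0 is n times the defect at n, and every other
  -- term has a smaller or negative argument. Since n > 0, the factor n cancels.
  jacobiDefect-zero : ∀ z → jacobiDefect z ≡ 0ℤ
  jacobiDefect-zero -[1+ k ] = jacobiDefect-negative k
  jacobiDefect-zero (+ n)    = <-rec (λ n → jacobiDefect (+ n) ≡ 0ℤ) step n
    where
    step : ∀ n → (∀ {m} → m ℕ.< n → jacobiDefect (+ m) ≡ 0ℤ) → jacobiDefect (+ n) ≡ 0ℤ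
    -- At 0 the recurrence carries no information. Evaluation gives `r₂` = `ι` = 1 and `E` = 0
    -- there.
    step zero    _  = refl
    step n@(suc _) ih = ℤ.*-cancelˡ-≡ (+ n) _ _ (begin
      + n * jacobiDefect (+ n)
        ≡⟨ cong₂ _*_ (sym (ℤ.+-identityʳ (+ n))) (cong jacobiDefect (sym (ℤ.+-identityʳ (+ n)))) ⟩
      f 0ℤ
        ≡⟨ ℤ.+-identityʳ (f 0ℤ) ⟨
      f 0ℤ + 0ℤ
        ≡⟨ +-congˡ (f 0ℤ) (∑-zero-∈ nonzero vanish) ⟨
      ∑ (interval n) f
        ≡⟨ ∑-w*jacobiDefect n ⟩
      0ℤ
        ≡⟨ ℤ.*-zeroʳ (+ n) ⟨
      + n * 0ℤ ∎)
      where
      open ≡-Reasoning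
      f : ℤ → ℤ
      f i = w n i * jacobiDefect (+ n - i * i)
      nonzero : List ℤ
      -- The head of `interval n` is 0, so by uniqueness the tail holds only nonzero integers.
      nonzero = drop 1 (interval n)
      smaller : ∀ k z → z ≡ + n - +[1+ k ] → jacobiDefect z ≡ 0ℤ
      smaller k -[1+ l ] _ = jacobiDefect-negative l
      smaller k (+ m)    e = ih (subst (m ℕ.<_) (ℤ.+-injective (≡-⇒+≡ +[1+ k ] (+ n) e))
        (ℕ.s≤s (ℕ.m≤n+m m k)))
      vanish : ∀ {i} → i ∈ nonzero → f i ≡ 0ℤ
      vanish {i} i∈ with square-positive (All.lookup (AllPairs.head (interval-unique n)) i∈ ∘ sym)
      ... | k , i²≡ = trans
        (cong (w n i *_) (smaller k _ (cong (λ z → + n - z) i²≡)))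
        (ℤ.*-zeroʳ (w n i))

  jacobi : ∀ {z} → 0ℤ < z → r₂ z ≡ + 4 * E z
  jacobi {+[1+ k ]} _ = trans
    (rearrange (r₂ +[1+ k ]) (E +[1+ k ]))
    (trans (cong₂ _+_ (jacobiDefect-zero +[1+ k ]) refl) (ℤ.+-identityˡ _))
    where
    rearrange : ∀ r e → r ≡ r + (- (+ 4) * e + -1ℤ * 0ℤ) + + 4 * e
    rearrange = solve-∀
  jacobi {+0} (+<+ ())

  -- Summation over the disc

  +card : (p : Finite P) → + card p ≡ ∑ᶠ p λ _ → 1ℤ
  +card p = length-∑ (Finite.elements p)
    where
    length-∑ : ∀ (xs : List A) → + length xs ≡ ∑ xs λ _ → 1ℤ
    length-∑ []       = refl
    length-∑ (x ∷ xs) = +-congˡ 1ℤ (length-∑ xs)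

  squares : ∀ x y → x ^ 2 + y ^ 2 ≡ x * x + y * y
  squares x y = cong₂ _+_ (cong (x *_) (ℤ.*-identityʳ x)) (cong (y *_) (ℤ.*-identityʳ y))

  -- Points are grouped by norm. The origin is the fibre over the extra norm 0, and `r₂ 0ℤ`
  -- evaluates to 1.
  ∑-disc : ∀ n → + F n ≡ 1ℤ + ∑ (range n) r₂
  ∑-disc n = trans (+card (disc-finite n))
    (∑ᶠ-fibres circle (disc-finite n) (0∉range ∷ range-unique n) (record
      { to      = λ (x , y) → x * x + y * y , x , y
      ; from    = proj₂
      ; to-∈    = λ {(x , y)} p → ∈-norms x y (subst (_≤ + n) (squares x y) p) , refl
      ; from-∈  = λ {(z , x , y)} (z∈ , e) →
          subst (_≤ + n) (sym (trans (squares x y) e)) (norms-bounded z∈)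
      ; from-to = λ _ → refl
      ; to-from = λ {(z , x , y)} (_ , e) → cong (_, x , y) e
      }) (λ _ _ → 1ℤ) (λ _ → refl))
    where
    0∉range : All (0ℤ ≢_) (range n)
    0∉range = All.tabulate λ z∈ 0≡z → ℤ.<-irrefl 0≡z (proj₁ (∈-range⁻ {n} z∈))
    ∈-norms : ∀ x y → x * x + y * y ≤ + n → x * x + y * y ∈ 0ℤ ∷ range n
    ∈-norms x y le = subst (_∈ 0ℤ ∷ range n) (circle-abs {x = x} {y} refl)
      (natural _ (subst (_≤ + n) (sym (circle-abs {x = x} {y} refl)) le))
      where
      natural : ∀ m → + m ≤ + n → + m ∈ 0ℤ ∷ range n
      natural zero    _   = here refl
      natural (suc m) m≤n = there (∈-range⁺ (+<+ (s≤s z≤n)) m≤n)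
    norms-bounded : ∀ {z} → z ∈ 0ℤ ∷ range n → z ≤ + n
    norms-bounded (here refl) = +≤+ z≤n
    norms-bounded (there z∈)  = proj₂ (∈-range⁻ z∈)

  Hyperbola : ℕ → Pred (ℤ × ℤ) 0ℓ
  Hyperbola n (d , δ) = 0ℤ < d × 0ℤ < δ × d * δ ≤ + n

  module _ (n : ℕ) where

    product-bounded : ∀ {d δ} → Hyperbola n (d , δ) → ∣ d ∣ ℕ.* ∣ δ ∣ ℕ.≤ n
    product-bounded (0<d , 0<δ , dδ≤n) =
      ℤ.drop‿+≤+ (subst (_≤ + n) (product-abs 0<d 0<δ) dδ≤n)

    hyperbola : Finite (Hyperbola n)
    hyperbola = finite-dec
      (λ (d , δ) → (0ℤ ℤ.<? d) ×-dec ((0ℤ ℤ.<? δ) ×-dec (d * δ ℤ.≤? + n)))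
      _ (intervals² n)
      λ {(d , δ)} p@(0<d , 0<δ , _) → let d≤ , δ≤ = divisions-bounded 0<d 0<δ in
        ∈-intervals² (ℕ.≤-trans d≤ (product-bounded {d} {δ} p)) (ℕ.≤-trans δ≤ (product-bounded {d} {δ} p))

    -- Factor pairs with product at most n are grouped by their product.
    ∑-E : ∑ (range n) E ≡ ∑ᶠ hyperbola λ (_ , δ) → χ δ
    ∑-E = sym (∑ᶠ-fibres divisions hyperbola (range-unique n) (record
      { to      = λ (d , δ) → d * δ , d , δ
      ; from    = proj₂
      ; to-∈    = λ (0<d , 0<δ , dδ≤n) →
          ∈-range⁺ (0<product 0<d 0<δ) dδ≤n , 0<d , 0<δ , refl
      ; from-∈  = λ (z∈ , 0<d , 0<δ , e) →
          0<d , 0<δ , subst (_≤ + n) (sym e) (proj₂ (∈-range⁻ z∈))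
      ; from-to = λ _ → refl
      ; to-from = λ {(z , d , δ)} (_ , _ , _ , e) → cong (_, d , δ) e
      }) (λ _ (_ , δ) → χ δ) (λ _ → refl))
      where
      0<product : ∀ {d δ} → 0ℤ < d → 0ℤ < δ → 0ℤ < d * δ
      0<product {+[1+ _ ]} {+[1+ _ ]} _ _ = +<+ (s≤s z≤n)
      0<product {+0} (+<+ ())
      0<product {+[1+ _ ]} {+0} _ (+<+ ())

    -- For fixed d = j + 1, δ runs from 1 to ⌊n/d⌋, and χ sums to c(⌊n/d⌋).
    ∑-hyperbola : ∑ᶠ hyperbola (λ (_ , δ) → χ δ) ≡ ∑ (downFrom n) λ j → c (n ℕ./ suc j)
    ∑-hyperbola = trans
      (∑ᶠ-fibres fibre hyperbola (Unique.downFrom⁺ n) (record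
        { to      = λ (d , δ) → ℕ.pred ∣ d ∣ , δ
        ; from    = λ (j , δ) → +[1+ j ] , δ
        ; to-∈    = λ {(d , δ)} → to-∈ d δ
        ; from-∈  = λ {(j , δ)} → from-∈ j δ
        ; from-to = λ { {+[1+ _ ] , _} _ → refl ; {+0 , _} (+<+ () , _) }
        ; to-from = λ _ → refl
        }) (λ _ → χ) (λ _ → refl))
      (∑-cong-∈ (downFrom n) λ {j} _ → ∑-range-χ (n ℕ./ suc j))
      where
      fibre : ∀ j → Finite (_∈ range (n ℕ./ suc j))
      fibre j = enumerated (range-unique (n ℕ./ suc j))
      to-∈ : ∀ d δ → Hyperbola n (d , δ) →
             ℕ.pred ∣ d ∣ ∈ downFrom n × δ ∈ range (n ℕ./ suc (ℕ.pred ∣ d ∣))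
      to-∈ +0 _ (+<+ () , _)
      to-∈ +[1+ j ] +0 (_ , +<+ () , _)
      to-∈ +[1+ j ] δ@(+[1+ k ]) p@(_ , 0<δ , _) =
        ∈-downFrom⁺ (ℕ.≤-trans (ℕ.m≤m*n (suc j) (suc k)) (product-bounded {+[1+ j ]} {δ} p)) ,
        ∈-range⁺ 0<δ (+≤+ (subst (ℕ._≤ n ℕ./ suc j) (trans (cong (ℕ._/ suc j) (ℕ.*-comm (suc j) (suc k))) (ℕ.m*n/n≡m (suc k) (suc j)))
          (ℕ./-monoˡ-≤ (suc j) (product-bounded {+[1+ j ]} {δ} p))))
      from-∈ : ∀ j δ → j ∈ downFrom n × δ ∈ range (n ℕ./ suc j) → Hyperbola n (+[1+ j ] , δ)
      from-∈ j δ (_ , δ∈) with ∈-range⁻ {n ℕ./ suc j} δ∈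
      from-∈ j +0 _ | +<+ () , _
      from-∈ j +[1+ k ] _ | 0<δ , +≤+ k≤ = +<+ (s≤s z≤n) , 0<δ , +≤+ (ℕ.≤-trans
        (ℕ.≤-reflexive (ℕ.*-comm (suc j) (suc k)))
        (ℕ.≤-trans (ℕ.*-monoˡ-≤ (suc j) k≤) (ℕ.m/n*n≤m n (suc j))))

    lattice-points : + F n ≡ 1ℤ + + 4 * ∑ (downFrom n) λ j → c (n ℕ./ suc j)
    lattice-points = trans (∑-disc n) (+-congˡ 1ℤ (begin
      ∑ (range n) r₂
        ≡⟨ ∑-cong-∈ (range n) (λ z∈ → jacobi (proj₁ (∈-range⁻ {n} z∈))) ⟩
      ∑ (range n) (λ z → + 4 * E z)
        ≡⟨ ∑-*ˡ (range n) (+ 4) E ⟩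
      + 4 * ∑ (range n) E
        ≡⟨ cong (+ 4 *_) (trans ∑-E ∑-hyperbola) ⟩
      + 4 * ∑ (downFrom n) (λ j → c (n ℕ./ suc j)) ∎))
      where open ≡-Reasoning

  -- The rounded quotients

  n/2≡⌊n/2⌋ : ∀ n → n ℕ./ 2 ≡ ℕ.⌊ n /2⌋
  n/2≡⌊n/2⌋ 0             = refl
  n/2≡⌊n/2⌋ 1             = refl
  n/2≡⌊n/2⌋ (suc (suc n)) =
    trans (ℕ.m/n≡1+[m∸n]/n {suc (suc n)} {2} (s≤s (s≤s z≤n))) (cong suc (n/2≡⌊n/2⌋ n))

  -- With k = j + 1, floor division by 2k is floor division by k and then by 2, and adding k to n
  -- raises the first quotient by 1.
  [n+k]/2k : ∀ n j → (n ℕ.+ suc j) ℕ./ (suc j ℕ.* 2) ≡ ℕ.⌊ suc (n ℕ./ suc j) /2⌋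
  [n+k]/2k n j = begin
    (n ℕ.+ suc j) ℕ./ (suc j ℕ.* 2)
      ≡⟨ ℕ.m/n/o≡m/[n*o] (n ℕ.+ suc j) (suc j) 2 ⟨
    (n ℕ.+ suc j) ℕ./ suc j ℕ./ 2
      ≡⟨ cong (ℕ._/ 2) (trans (ℕ.m/n≡1+[m∸n]/n (ℕ.m≤n+m (suc j) n))
           (cong (λ m → suc (m ℕ./ suc j)) (ℕ.m+n∸n≡m n (suc j)))) ⟩
    suc (n ℕ./ suc j) ℕ./ 2
      ≡⟨ n/2≡⌊n/2⌋ _ ⟩
    ℕ.⌊ suc (n ℕ./ suc j) /2⌋ ∎
    where open ≡-Reasoning

  -- A rational is stored in lowest terms, which hides its numerator, so the floor is read off any
  -- fraction a/(b + 1) equal to it. Scaling each quotient by the other denominator makes the two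
  -- agree.
  floor-≃ : ∀ p a b → ℚ.toℚᵘ p ℚᵘ.≃ ℚᵘ.mkℚᵘ (+ a) b → ℚ.floor p ≡ + (a ℕ./ suc b)
  floor-≃ (ℚ.mkℚ -[1+ m ] d _) a b (ℚᵘ.*≡* e) with trans e (sym (ℤ.pos-* a (suc d)))
  ... | ()
  floor-≃ (ℚ.mkℚ (+ m) d _) a b (ℚᵘ.*≡* e) = trans (ℤ.*-identityˡ _) (cong +_ (begin
    m ℕ./ suc d                       ≡⟨ ℕ.m*n/o*n≡m/o m (suc b) (suc d) ⟨
    (m ℕ.* suc b) ℕ./ (suc d ℕ.* suc b) ≡⟨ ℕ./-congˡ {o = suc d ℕ.* suc b} cross ⟩
    (a ℕ.* suc d) ℕ./ (suc d ℕ.* suc b) ≡⟨ ℕ./-congʳ {m = a ℕ.* suc d} (ℕ.*-comm (suc d) (suc b)) ⟩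
    (a ℕ.* suc d) ℕ./ (suc b ℕ.* suc d) ≡⟨ ℕ.m*n/o*n≡m/o a (suc d) (suc b) ⟩
    a ℕ./ suc b                       ∎))
    where
    open ≡-Reasoning
    cross : m ℕ.* suc b ≡ a ℕ.* suc d
    cross = ℤ.+-injective (trans (ℤ.pos-* m (suc b)) (trans e (sym (ℤ.pos-* a (suc d)))))

  module _ {p q : ℚ} {a b : ℚᵘ.ℚᵘ} (p≃a : ℚ.toℚᵘ p ℚᵘ.≃ a) (q≃b : ℚ.toℚᵘ q ℚᵘ.≃ b) where

    toℚᵘ-+ : ℚ.toℚᵘ (p ℚ.+ q) ℚᵘ.≃ a ℚᵘ.+ b
    toℚᵘ-+ = ℚᵘ.≃-trans (ℚ.toℚᵘ-homo-+ p q) (ℚᵘ.+-cong p≃a q≃b)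

    toℚᵘ-* : ℚ.toℚᵘ (p ℚ.* q) ℚᵘ.≃ a ℚᵘ.* b
    toℚᵘ-* = ℚᵘ.≃-trans (ℚ.toℚᵘ-homo-* p q) (ℚᵘ.*-cong p≃a q≃b)

  toℚᵘ-neg : ∀ {p a} → ℚ.toℚᵘ p ℚᵘ.≃ a → ℚ.toℚᵘ (ℚ.- p) ℚᵘ.≃ ℚᵘ.- a
  toℚᵘ-neg {p} p≃a = ℚᵘ.≃-trans (ℚ.toℚᵘ-homo‿- p) (ℚᵘ.-‿cong p≃a)

  toℚᵘ-/ : ∀ i b → ℚ.toℚᵘ (i ℚ./ suc b) ℚᵘ.≃ ℚᵘ.mkℚᵘ i b
  toℚᵘ-/ i b = ℚ.toℚᵘ-fromℚᵘ (ℚᵘ.mkℚᵘ i b)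

  -- ⌈n/2⌉ - {n/2} = ⌈n/2⌉ + ⌊n/2⌋ - n/2 = n/2. The last argument of `mkℚᵘ` is the denominator minus
  -- 1.
  ⌈n/2⌉-frac : ∀ n → ℚ.toℚᵘ ((+ ℕ.⌈ n /2⌉ ℚ./ 1) ℚ.- frac (+ n ℚ./ 2)) ℚᵘ.≃ ℚᵘ.mkℚᵘ (+ n) 1
  ⌈n/2⌉-frac n = ℚᵘ.≃-trans
    (toℚᵘ-+ (toℚᵘ-/ (+ ℕ.⌈ n /2⌉) 0) (toℚᵘ-neg
      (toℚᵘ-+ {p = + n ℚ./ 2} (toℚᵘ-/ (+ n) 1) (toℚᵘ-neg (toℚᵘ-/ ⌊n/2⌋ 0)))))
    (ℚᵘ.*≡* (begin
      (+ ℕ.⌈ n /2⌉ * + 2 + - (+ n * + 1 + - ⌊n/2⌋ * + 2) * + 1) * + 2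
        ≡⟨ cong (λ z → (+ ℕ.⌈ n /2⌉ * + 2 + - (+ n * + 1 + - z * + 2) * + 1) * + 2) floor≡ ⟩
      (+ ℕ.⌈ n /2⌉ * + 2 + - (+ n * + 1 + - + ℕ.⌊ n /2⌋ * + 2) * + 1) * + 2
        ≡⟨ cong (λ z → (+ ℕ.⌈ n /2⌉ * + 2 + - (z * + 1 + - + ℕ.⌊ n /2⌋ * + 2) * + 1) * + 2) n≡ ⟨
      (+ ℕ.⌈ n /2⌉ * + 2 + - ((+ ℕ.⌊ n /2⌋ + + ℕ.⌈ n /2⌉) * + 1 + - + ℕ.⌊ n /2⌋ * + 2) * + 1) * + 2
        ≡⟨ lemma (+ ℕ.⌊ n /2⌋) (+ ℕ.⌈ n /2⌉) ⟩
      (+ ℕ.⌊ n /2⌋ + + ℕ.⌈ n /2⌉) * + 2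
        ≡⟨ cong (_* + 2) n≡ ⟩
      + n * + 2 ∎))
    where
    open ≡-Reasoning
    ⌊n/2⌋ = ℚ.floor (+ n ℚ./ 2)
    floor≡ : ⌊n/2⌋ ≡ + ℕ.⌊ n /2⌋
    floor≡ = trans (floor-≃ (+ n ℚ./ 2) n 1 (toℚᵘ-/ (+ n) 1)) (cong +_ (n/2≡⌊n/2⌋ n))
    n≡ : + ℕ.⌊ n /2⌋ + + ℕ.⌈ n /2⌉ ≡ + n
    n≡ = cong +_ (ℕ.⌊n/2⌋+⌈n/2⌉≡n n)
    lemma : ∀ l h → (h * + 2 + - ((l + h) * + 1 + - l * + 2) * + 1) * + 2 ≡ (l + h) * + 2
    lemma = solve-∀

  -- With k = j + 1, (n/2)/k + 1/2 = (n + k)/(2k).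
  floorTerm≡ : ∀ n j → floorTerm ℕ.⌈ n /2⌉ ℚ.½ (frac (+ n ℚ./ 2)) (+ 1) 2 (suc j)
                       ≡ + ℕ.⌊ suc (n ℕ./ suc j) /2⌋
  floorTerm≡ n j = trans
    (floor-≃ _ (n ℕ.+ suc j) (ℕ.pred (suc j ℕ.* 2)) (ℚᵘ.≃-trans
      (toℚᵘ-+ {b = ℚᵘ.½} (toℚᵘ-* (⌈n/2⌉-frac n) (toℚᵘ-/ (+ 1) j)) ℚᵘ.≃-refl)
      (ℚᵘ.*≡* (begin
        (+ n * + 1 * + 2 + + 1 * + (2 ℕ.* suc j)) * + (suc j ℕ.* 2)
          ≡⟨ cong (λ m → (+ n * + 1 * + 2 + + 1 * m) * + (suc j ℕ.* 2)) (ℤ.pos-* 2 (suc j)) ⟩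
        (+ n * + 1 * + 2 + + 1 * (+ 2 * +[1+ j ])) * + (suc j ℕ.* 2)
          ≡⟨ cong (λ m → (+ n * + 1 * + 2 + + 1 * (+ 2 * +[1+ j ])) * m) (ℤ.pos-* (suc j) 2) ⟩
        (+ n * + 1 * + 2 + + 1 * (+ 2 * +[1+ j ])) * (+[1+ j ] * + 2)
          ≡⟨ lemma (+ n) +[1+ j ] ⟩
        (+ n + +[1+ j ]) * (+ 2 * +[1+ j ] * + 2)
          ≡⟨ cong (λ m → (+ n + +[1+ j ]) * (m * + 2)) (ℤ.pos-* 2 (suc j)) ⟨
        (+ n + +[1+ j ]) * (+ (2 ℕ.* suc j) * + 2)
          ≡⟨ cong ((+ n + +[1+ j ]) *_) (ℤ.pos-* (2 ℕ.* suc j) 2) ⟨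
        (+ n + +[1+ j ]) * + (2 ℕ.* suc j ℕ.* 2) ∎))))
    (cong +_ ([n+k]/2k n j))
    where
    open ≡-Reasoning
    lemma : ∀ n k → (n * + 1 * + 2 + + 1 * (+ 2 * k)) * (k * + 2) ≡ (n + k) * (+ 2 * k * + 2)
    lemma = solve-∀

  -- Raising m by 4 preserves c(m) and adds 2 to ⌊(m + 1)/2⌋, so the four residues decide.
  c-parity : ∀ m → (c m ≡ 1ℤ × ((+ ℕ.⌊ suc m /2⌋) ≡ (+ 1) [mod 2 ]))
                 ⊎ (c m ≡ 0ℤ × ¬ ((+ ℕ.⌊ suc m /2⌋) ≡ (+ 1) [mod 2 ]))
  c-parity 0 = inj₂ (refl , from-no (+ 2 ∣? -1ℤ))
  c-parity 1 = inj₁ (refl , from-yes (+ 2 ∣? 0ℤ))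
  c-parity 2 = inj₁ (refl , from-yes (+ 2 ∣? 0ℤ))
  c-parity 3 = inj₂ (refl , from-no (+ 2 ∣? 1ℤ))
  c-parity (suc (suc (suc (suc m)))) with c-parity m
  ... | inj₁ (e , 2∣) = inj₁ (e , subst (+ 2 ∣_)
          (sym (ℤ.+-assoc (+ 2) (+ ℕ.⌊ suc m /2⌋) -1ℤ)) (∣m∣n⇒∣m+n ∣-refl 2∣))
  ... | inj₂ (e , 2∤) = inj₂ (e , λ 2∣ → 2∤ (∣m+n∣m⇒∣n
          (subst (+ 2 ∣_) (ℤ.+-assoc (+ 2) (+ ℕ.⌊ suc m /2⌋) -1ℤ) 2∣) ∣-refl))

  -- Comparison of the two counts

  module _ (n : ℕ) where

    l = ℕ.⌊ n /2⌋
    h = ℕ.⌈ n /2⌉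

    term : ℕ → ℤ
    term j = c (n ℕ./ suc j)

    counted : Finite (Counted h ℚ.½ (frac (+ n ℚ./ 2)) (+ 1) 2)
    counted = counted-finite h ℚ.½ (frac (+ n ℚ./ 2)) (+ 1) 2

    -- The terms are 0 or 1, so the sum counts the ones. The shift j ↦ j + 1 passes from indices
    -- starting at 0 to the counted k ≥ 1.
    ∑-counted : ∑ (downFrom h) term ≡ + card counted
    ∑-counted = begin
      ∑ (downFrom h) term
        ≡⟨ ∑-filter one? (downFrom h) term ⟩
      ∑ᶠ ones term + ∑ (filter (¬? ∘ one?) (downFrom h)) term
        ≡⟨ cong₂ _+_ (∑ᶠ-cong ones proj₂) (∑-zero-∈ (filter (¬? ∘ one?) (downFrom h))
             (λ {j} j∈ → not-one j (proj₂ (∈-filter⁻ (¬? ∘ one?) {xs = downFrom h} j∈)))) ⟩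
      ∑ᶠ ones (λ _ → 1ℤ) + 0ℤ
        ≡⟨ ℤ.+-identityʳ _ ⟩
      ∑ᶠ ones (λ _ → 1ℤ)
        ≡⟨ ∑ᶠ-≅ ones counted (record
             { to      = suc
             ; from    = ℕ.pred
             ; to-∈    = λ {j} (j∈ , e) → s≤s z≤n , ∈-downFrom⁻ j∈ , odd j e
             ; from-∈  = λ { {suc j} (_ , j<h , o) → ∈-downFrom⁺ j<h , one j o }
             ; from-to = λ _ → refl
             ; to-from = λ { {suc _} _ → refl }
             }) (λ _ → refl) ⟩
      ∑ᶠ counted (λ _ → 1ℤ)
        ≡⟨ +card counted ⟨
      + card counted ∎
      where
      open ≡-Reasoning
      one? : Decidable (λ j → term j ≡ 1ℤ)
      one? j = term j ℤ.≟ 1ℤ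
      ones : Finite ((_∈ downFrom h) ∩ λ j → term j ≡ 1ℤ)
      ones = restrict one? (enumerated (Unique.downFrom⁺ h))
      not-one : ∀ j → term j ≢ 1ℤ → term j ≡ 0ℤ
      not-one j ≢1 with c-parity (n ℕ./ suc j)
      ... | inj₁ (≡1 , _) = ⊥-elim (≢1 ≡1)
      ... | inj₂ (≡0 , _) = ≡0
      odd : ∀ j → term j ≡ 1ℤ → ((floorTerm h ℚ.½ (frac (+ n ℚ./ 2)) (+ 1) 2 (suc j)) ≡ (+ 1) [mod 2 ])
      odd j ≡1 with c-parity (n ℕ./ suc j)
      ... | inj₁ (_ , o) = subst (_≡ (+ 1) [mod 2 ]) (sym (floorTerm≡ n j)) o
      ... | inj₂ (≡0 , _) with trans (sym ≡1) ≡0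
      ...   | ()
      one : ∀ j → ((floorTerm h ℚ.½ (frac (+ n ℚ./ 2)) (+ 1) 2 (suc j)) ≡ (+ 1) [mod 2 ]) → term j ≡ 1ℤ
      one j o with c-parity (n ℕ./ suc j)
      ... | inj₁ (≡1 , _) = ≡1
      ... | inj₂ (_ , ¬o) = ⊥-elim (¬o (subst (_≡ (+ 1) [mod 2 ]) (floorTerm≡ n j) o))

    -- For k = j + 1 the bounds give k ≤ n < 2k, so the quotient is 1 and c(1) = 1.
    term-large : ∀ {j} → h ℕ.≤ j → j ℕ.< n → term j ≡ 1ℤ
    term-large {j} h≤j j<n = cong c (trans
      (ℕ.m/n≡1+[m∸n]/n j<n)
      (cong suc (ℕ.m<n⇒m/n≡0 (ℕ.m<n+o⇒m∸n<o n (suc j) n<2k))))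
      where
      n<2k : n ℕ.< suc j ℕ.+ suc j
      n<2k = ℕ.≤-<-trans
        (ℕ.≤-trans (ℕ.≤-reflexive (sym (ℕ.⌊n/2⌋+⌈n/2⌉≡n n))) (ℕ.+-monoˡ-≤ h (ℕ.⌊n/2⌋≤⌈n/2⌉ n)))
        (ℕ.+-mono-<-≤ (s≤s h≤j) (ℕ.m≤n⇒m≤1+n h≤j))

    ∑-downFrom-term : ∀ a → a ℕ.+ h ℕ.≤ n → ∑ (downFrom (a ℕ.+ h)) term ≡ + a + ∑ (downFrom h) term
    ∑-downFrom-term zero    _    = sym (ℤ.+-identityˡ _)
    ∑-downFrom-term (suc a) a+h<n = trans
      (cong₂ _+_ (term-large (ℕ.m≤n+m h a) a+h<n) (∑-downFrom-term a (ℕ.<⇒≤ a+h<n)))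
      (sym (ℤ.+-assoc 1ℤ (+ a) (∑ (downFrom h) term)))

    F≡ : F n ≡ 4 ℕ.* card counted ℕ.+ 4 ℕ.* l ℕ.+ 1
    F≡ = ℤ.+-injective (begin
      + F n
        ≡⟨ lattice-points n ⟩
      1ℤ + + 4 * ∑ (downFrom n) term
        ≡⟨ cong (λ m → 1ℤ + + 4 * ∑ (downFrom m) term) l+h≡n ⟨
      1ℤ + + 4 * ∑ (downFrom (l ℕ.+ h)) term
        ≡⟨ cong (λ z → 1ℤ + + 4 * z) (trans
             (∑-downFrom-term l (ℕ.≤-reflexive l+h≡n)) (+-congˡ (+ l) ∑-counted)) ⟩
      1ℤ + + 4 * (+ l + + card counted)
        ≡⟨ lemma (+ l) (+ card counted) ⟩
      + 4 * + card counted + + 4 * + l + 1ℤ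
        ≡⟨ cong (_+ 1ℤ) (cong₂ _+_ (ℤ.pos-* 4 (card counted)) (ℤ.pos-* 4 l)) ⟨
      + (4 ℕ.* card counted ℕ.+ 4 ℕ.* l ℕ.+ 1) ∎)
      where
      open ≡-Reasoning
      l+h≡n = ℕ.⌊n/2⌋+⌈n/2⌉≡n n
      lemma : ∀ l c → 1ℤ + + 4 * (l + c) ≡ + 4 * c + + 4 * l + 1ℤ
      lemma = solve-∀

open import Data.Nat.Base using (ℕ; NonZero; _+_; _*_; ⌊_/2⌋; ⌈_/2⌉)
open import Data.Integer.Base using (+_)
open import Data.Rational.Base using (_/_; ½)

proposition5p1 : (n : ℕ) .{{_ : NonZero n}} →
    F n ≡ 4 * 𝒩 ⌈ n /2⌉ ½ (frac (+ n / 2)) (+ 1) 2 + 4 * ⌊ n /2⌋ + 1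
proposition5p1 n = DiscCount.F≡ n
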